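{- Let $m=m_n\ge1$ and $d=d_n$ be integers with $2\le d\le n$, and let $G_{nmd}$ be the random graph on $\{1,\dots,n\}$ obtained by sampling mutually independent uniformly random $d$-element subsets $V_1,\dots,V_m$ of $\{1,\dots,n\}$ and declaring distinct nodes $i,j$ adjacent iff some $V_k$ contains both. Then, as $n\to\infty$, \[ \mathbb{P}(G_{nmd} \text{ is connected}) \to \begin{cases} 0 & \text{if } \log n + m\log(1-d/n) \to +\infty,\\ 1 & \text{if } \log n + m\log(1-d/n) \to -\infty.\end{cases} \]
   Context: Convention $\log 0=-\infty$. -}

module Defs where

import Algebra.Definitions.RawSemiring
open import Data.Fin using (Fin)
import Data.Fin.Properties as Fin
open import Data.Fin.Subset using (Subset; inside; outside; _∈_; ∣_∣)
open import Data.Fin.Subset.Properties using (_∈?_)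
open import Data.Integer using (+_)
open import Data.List using (List; []; _∷_; [_]; _++_; map; filter; foldr; length; allFin; cartesianProductWith)
open import Data.List.Membership.Propositional using () renaming (_∈_ to _∈ˡ_)
open import Data.List.Membership.Propositional.Properties using (∈-allFin)
open import Data.List.Relation.Unary.Any using (here; there)
open import Data.Nat as ℕ using (ℕ; zero; suc; NonZero)
open import Data.Product using (_×_; _,_; proj₁; proj₂; ∃-syntax)
open import Data.Rational using (ℚ; 0ℚ; 1ℚ; _+_; _-_; _*_; _/_; _≤_; _<_; +-*-rawSemiring) renaming (∣_∣ to abs)
open import Data.Sum using (_⊎_; inj₁; inj₂)
open import Data.Vec using (Vec; []; _∷_; lookup)
open import Function using (_∘_)
open import Level using (0ℓ)
open import Relation.Binary using (Rel) renaming (Decidable to Decidable₂)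
open import Relation.Binary.Construct.Closure.ReflexiveTransitive using (Star; ε; _◅_; _◅◅_)
open import Relation.Binary.PropositionalEquality using (_≡_; _≢_; refl)
open import Relation.Nullary using (Dec; ¬?; _×-dec_; _⊎-dec_)
open import Relation.Nullary.Decidable using (map′)
open import Relation.Unary using (Pred; Decidable)

open Algebra.Definitions.RawSemiring +-*-rawSemiring using (_^_)

private
  variable
    A : Set

fromℕ : ℕ → ℚ
fromℕ n = + n / 1

Dist : Set → Set
Dist A = List (A × ℚ)

-- Uniform on the entries of a nonempty list without repetitions.
uniform : List A → Dist A
uniform []          = []
uniform xs@(_ ∷ _) = map (λ x → x , + 1 / length xs) xs

-- The m-fold product measure: the joint law of m mutually independent
-- random elements, each with law μ.
iid : (m : ℕ) → Dist A → Dist (Vec A m)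
iid zero    μ = [ [] , 1ℚ ]
iid (suc m) μ = cartesianProductWith (λ (x , p) (xs , q) → x ∷ xs , p * q) μ (iid m μ)

Pr : Dist A → {P : Pred A 0ℓ} → Decidable P → ℚ
Pr μ P? = foldr _+_ 0ℚ (map proj₂ (filter (P? ∘ proj₁) μ))

Graph : ℕ → Set₁
Graph n = Rel (Fin n) 0ℓ

Connected : ∀ {n} → Graph n → Set
Connected Adj = ∀ i j → Star Adj i j

-- Connectedness is decidable (Warshall's algorithm): Via xs relates i and
-- j when they are joined by a walk whose inner nodes all lie in xs.
module _ {n : ℕ} {Adj : Graph n} (adj? : Decidable₂ Adj) where

  private
    Via : List (Fin n) → Graph n
    Via []       i j = i ≡ j ⊎ Adj i j
    Via (x ∷ xs) i j = Via xs i j ⊎ (Via xs i x × Via xs x j)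

    via? : ∀ xs → Decidable₂ (Via xs)
    via? []       i j = (i Fin.≟ j) ⊎-dec adj? i j
    via? (x ∷ xs) i j = via? xs i j ⊎-dec (via? xs i x ×-dec via? xs x j)

    via⇒star : ∀ xs {i j} → Via xs i j → Star Adj i j
    via⇒star []       (inj₁ refl)    = ε
    via⇒star []       (inj₂ a)       = a ◅ ε
    via⇒star (x ∷ xs) (inj₁ w)       = via⇒star xs w
    via⇒star (x ∷ xs) (inj₂ (w , v)) = via⇒star xs w ◅◅ via⇒star xs v

    base : ∀ xs {i j} → i ≡ j ⊎ Adj i j → Via xs i j
    base []       b = b
    base (x ∷ xs) b = inj₁ (base xs b)

    to-pivot : ∀ {x xs i} → Via (x ∷ xs) i x → Via xs i x
    to-pivot (inj₁ w)       = w
    to-pivot (inj₂ (w , _)) = w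

    from-pivot : ∀ {x xs j} → Via (x ∷ xs) x j → Via xs x j
    from-pivot (inj₁ w)       = w
    from-pivot (inj₂ (_ , w)) = w

    join : ∀ {xs v i j} → v ∈ˡ xs → Via xs i v → Via xs v j → Via xs i j
    join (here refl) p q = inj₂ (to-pivot p , from-pivot q)
    join (there v∈)  (inj₁ p)       (inj₁ q)       = inj₁ (join v∈ p q)
    join (there v∈)  (inj₁ p)       (inj₂ (q , r)) = inj₂ (join v∈ p q , r)
    join (there v∈)  (inj₂ (p , q)) (inj₁ r)       = inj₂ (p , join v∈ q r)
    join (there v∈)  (inj₂ (p , _)) (inj₂ (_ , q)) = inj₂ (p , q)

    star⇒via : ∀ {i j} → Star Adj i j → Via (allFin n) i j
    star⇒via ε       = base (allFin n) (inj₁ refl)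
    star⇒via (a ◅ s) = join (∈-allFin _) (base (allFin n) (inj₂ a)) (star⇒via s)

  connected? : Dec (Connected Adj)
  connected? = Fin.all? λ i → Fin.all? λ j →
    map′ (via⇒star (allFin n)) star⇒via (via? (allFin n) i j)

subsets : ∀ n → List (Subset n)
subsets zero    = [ [] ]
subsets (suc n) = map (outside ∷_) (subsets n) ++ map (inside ∷_) (subsets n)

subsetsOfSize : (n d : ℕ) → List (Subset n)
subsetsOfSize n d = filter (λ p → ∣ p ∣ ℕ.≟ d) (subsets n)

-- The law of (V₁, …, V_m).
sample : (n m d : ℕ) → Dist (Vec (Subset n) m)
sample n m d = iid m (uniform (subsetsOfSize n d))

G : ∀ {n m} → Vec (Subset n) m → Graph n
G V i j = i ≢ j × ∃[ k ] (i ∈ lookup V k × j ∈ lookup V k)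

adjacent? : ∀ {n m} (V : Vec (Subset n) m) → Decidable₂ (G V)
adjacent? V i j =
  ¬? (i Fin.≟ j) ×-dec Fin.any? λ k → (i ∈? lookup V k) ×-dec (j ∈? lookup V k)

ℙ[G-connected] : (n m d : ℕ) → ℚ
ℙ[G-connected] n m d = Pr (sample n m d) (λ V → connected? (adjacent? V))

-- An extended real y is represented by its two open rational cuts
-- { q | q < y } and { q | y < q }; -∞ has cuts ∅ and ℚ. The cut axioms are
-- not bundled: only the cuts built from log below are ever used.
record ℝ∞ : Set₁ where
  field
    below : ℚ → Set
    above : ℚ → Set
open ℝ∞ public

infix 4 _<ʳ_ _ʳ<_

_<ʳ_ : ℚ → ℝ∞ → Set
q <ʳ y = below y q

_ʳ<_ : ℝ∞ → ℚ → Set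
y ʳ< q = above y q

0ʳ : ℝ∞
0ʳ .below q = q < 0ℚ
0ʳ .above q = 0ℚ < q

infixl 6 _+ʳ_
_+ʳ_ : ℝ∞ → ℝ∞ → ℝ∞
(x +ʳ y) .below q = ∃[ a ] ∃[ b ] (a <ʳ x × b <ʳ y × q ≡ a + b)
(x +ʳ y) .above q = ∃[ a ] ∃[ b ] (x ʳ< a × y ʳ< b × q ≡ a + b)

infixr 7 _·ʳ_
_·ʳ_ : ℕ → ℝ∞ → ℝ∞
zero  ·ʳ y = 0ʳ
suc m ·ʳ y = y +ʳ m ·ʳ y

-- Strict comparison of the limit of a convergent rational sequence with a
-- rational number.
lim_<_ : (ℕ → ℚ) → ℚ → Set
lim s < x = ∃[ δ ] (0ℚ < δ × ∃[ N ] (∀ k → N ℕ.≤ k → s k + δ ≤ x))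

_<lim_ : ℚ → (ℕ → ℚ) → Set
x <lim s = ∃[ δ ] (0ℚ < δ × ∃[ N ] (∀ k → N ℕ.≤ k → x + δ ≤ s k))

-- exp q is the limit of (1 + q / k) ^ k, here with k shifted by one.
expSeq : ℚ → ℕ → ℚ
expSeq q k = (1ℚ + q * (+ 1 / suc k)) ^ suc k

-- The inverse function of exp: q < log x iff exp q < x, and log x < q iff
-- x < exp q. As exp is positive, this gives log 0 = -∞.
log : ℚ → ℝ∞
log x .below q = lim expSeq q < x
log x .above q = x <lim expSeq q

_⟶+∞ : ((n : ℕ) → .{{NonZero n}} → ℝ∞) → Set
s ⟶+∞ = ∀ K → ∃[ N ] (∀ n → .{{_ : NonZero n}} → N ℕ.≤ n → K <ʳ s n)

_⟶-∞ : ((n : ℕ) → .{{NonZero n}} → ℝ∞) → Set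
s ⟶-∞ = ∀ K → ∃[ N ] (∀ n → .{{_ : NonZero n}} → N ℕ.≤ n → s n ʳ< K)

infix 4 _⟶_
_⟶_ : (ℕ → ℚ) → ℚ → Set
p ⟶ l = ∀ δ → 0ℚ < δ → ∃[ N ] (∀ n → N ℕ.≤ n → abs (p n - l) < δ)

log[n]+m·log[1-d/n] : (n m d : ℕ) → .{{NonZero n}} → ℝ∞
log[n]+m·log[1-d/n] n m d = log (fromℕ n) +ʳ m ·ʳ log (1ℚ - + d / n)

{-# OPTIONS --safe #-}

-- Write q = 1 - d/n. The expected number of uncovered (hence isolated) nodes is n q^m, and
-- the events that two nodes are uncovered are negatively correlated; by Chebyshev's inequality
-- some node is isolated with high probability when n q^m → ∞.
--
-- When n q^m → 0, sum over the sets S of size s ≤ n/2 the probability that no V_k meets both S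
-- and its complement. A single d-set fails to meet both with probability at most
-- q ^ (s (n - s) / (n - 1)), by induction on d. As n ^ (s - 1) ≤ s ^ (n - 1), C(n, s) ≤ n ^ s / s!
-- and s ^ s ≤ 4 ^ s s!, the sum is dominated by a geometric series whose ratio is of order
-- (n q^m) ^ (1/2). These estimates are instances of the weighted AM-GM inequality; fractional
-- exponents are cleared by raising both sides to the power n - 1.

module Submission where

-- Probabilities appear only at the very end. With N = C(n, d), an event is measured by the number
-- of tuples in which it occurs, out of N^m, and each estimate is an inequality of naturals with all
-- denominators multiplied out; so q = 0 needs no case of its own. A cut of log n + m log q becomes
-- a bound on n q^m through exp x ≥ x alone. The loss is harmless, as the cut can be taken as far
-- out as desired.
--
-- The obstacle is that d is arbitrary between 2 and n, so one bound on a set lying on one side of a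
-- cut has to serve for all d. The exponent s (n - s) / (n - 1) is 1 at s = 1, where the bound is an
-- equality, so the terms of the union bound start at the right order n q^m. For it to combine with
-- C(n, s) into a power of n q^m, the same exponent of n must come out of C(n, s); that is the
-- purpose of n ^ (s - 1) ≤ s ^ (n - 1). For s ≤ n/2 the exponent is at least s/2, which is where
-- the square root in the ratio comes from.

module Arithmetic where

  open import Data.List using (_∷_; [])
  open import Data.Nat using (ℕ; zero; suc; _+_; _*_; _∸_; _^_; _≤_; _<_; z≤n; s≤s; NonZero; >-nonZero; >-nonZero⁻¹; _!; _≤′_; ≤′-refl; ≤′-step)
  open import Data.Nat.Combinatorics using (_C_; k>n⇒nCk≡0; nC1≡n; nCk+nC[k+1]≡[n+1]C[k+1])
  open import Data.Nat.Properties
  open import Algebra.Properties.CommutativeSemigroup *-commutativeSemigroup using (x∙yz≈y∙xz)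
  open import Data.Nat.Tactic.RingSolver using (solve)
  open import Data.Product using (_,_)
  open import Data.Sum using (inj₁; inj₂)
  open import Relation.Binary.PropositionalEquality using (_≡_; refl; sym; trans; cong; cong₂; subst; subst₂)

  -- The weighted AM-GM inequality over the naturals

  2xy≤x²+y² : ∀ x y → 2 * (x * y) ≤ x * x + y * y
  2xy≤x²+y² x y with ≤-total x y
  ... | inj₁ x≤y with e , refl ← m≤n⇒∃[o]m+o≡n x≤y = m+n≤o⇒m≤o (2 * (x * (x + e))) {e * e} (≤-reflexive (solve (x ∷ e ∷ [])))
  ... | inj₂ y≤x with e , refl ← m≤n⇒∃[o]m+o≡n y≤x = m+n≤o⇒m≤o (2 * ((y + e) * y)) {e * e} (≤-reflexive (solve (y ∷ e ∷ [])))

  -- Homogeneous form of (z/x)^(k+1) ≥ 1 + (k+1)(z/x - 1), with the negative term moved across. In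
  -- the induction the mixed term is split by `2xy≤x²+y²`.
  bernoulli : ∀ k x z → suc k * (z * x ^ k) ≤ z ^ suc k + k * x ^ suc k
  bernoulli zero    x z = ≤-refl
  bernoulli (suc k) x z = step (x ^ k) (z ^ suc k) (bernoulli k x z)
    where
    open ≤-Reasoning
    step : ∀ p r → suc k * (z * p) ≤ r + k * (x * p) →
           suc (suc k) * (z * (x * p)) ≤ z * r + suc k * (x * (x * p))
    step p r ih = +-cancelʳ-≤ (k * (z * (x * p)) + suc k * (z * (z * p))) _ _ (begin
      suc (suc k) * (z * (x * p)) + (k * (z * (x * p)) + suc k * (z * (z * p)))
        ≡⟨ solve (k ∷ x ∷ z ∷ p ∷ []) ⟩
      z * (suc k * (z * p)) + suc k * p * (2 * (z * x))
        ≤⟨ +-mono-≤ (*-monoʳ-≤ z ih) (*-monoʳ-≤ (suc k * p) (2xy≤x²+y² z x)) ⟩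
      z * (r + k * (x * p)) + suc k * p * (z * z + x * x)
        ≡⟨ solve (k ∷ x ∷ z ∷ p ∷ r ∷ []) ⟩
      (z * r + suc k * (x * (x * p))) + (k * (z * (x * p)) + suc k * (z * (z * p))) ∎)

  ^-distribʳ-* : ∀ n x y → (x * y) ^ n ≡ x ^ n * y ^ n
  ^-distribʳ-* zero    x y = refl
  ^-distribʳ-* (suc n) x y rewrite ^-distribʳ-* n x y = [m*n]*[o*p]≡[m*o]*[n*p] x y (x ^ n) (y ^ n)

  ^-swap : ∀ x m n → (x ^ m) ^ n ≡ (x ^ n) ^ m
  ^-swap x m n = trans (^-*-assoc x m n) (trans (cong (x ^_) (*-comm m n)) (sym (^-*-assoc x n m)))

  n^n≢0 : ∀ n → NonZero (n ^ n)
  n^n≢0 zero    = _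
  n^n≢0 (suc n) = m^n≢0 (suc n) (suc n)

  -- Bernoulli's inequality for z = k (y + b) and x = (k + 1) y.
  mean-step : ∀ k y b → suc k ^ suc k * (b * y ^ k) ≤ k ^ k * (y + b) ^ suc k
  mean-step zero      y b = subst₂ _≤_ (unit b) (unit (y + b)) (m≤n+m b y)
    where
    unit : ∀ t → t ≡ 1 * (t * 1)
    unit t = solve (t ∷ [])
  -- Bernoulli's inequality delivers the claim multiplied by k, which is cancelled here; hence the
  -- separate case k = 0.
  mean-step k@(suc j) y b = *-cancelˡ-≤ k (+-cancelʳ-≤ (k * x ^ suc k) _ _ (begin
    k * (suc k ^ suc k * (b * y ^ k)) + k * (x * x ^ k)
      ≡⟨ cong (λ t → k * (suc k ^ suc k * (b * y ^ k)) + k * (x * t)) (^-distribʳ-* k (suc k) y) ⟩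
    k * (suc k * suc k ^ k * (b * y ^ k)) + k * (suc k * y * (suc k ^ k * y ^ k))
      ≡⟨ lhs k (suc k ^ k) (y ^ k) ⟩
    suc k * (k * (y + b) * (suc k ^ k * y ^ k))
      ≡⟨ cong (λ t → suc k * (k * (y + b) * t)) (^-distribʳ-* k (suc k) y) ⟨
    suc k * (k * (y + b) * x ^ k)
      ≤⟨ bernoulli k x (k * (y + b)) ⟩
    (k * (y + b)) ^ suc k + k * x ^ suc k
      ≡⟨ cong (_+ k * x ^ suc k) (trans (^-distribʳ-* (suc k) k (y + b)) (*-assoc k (k ^ k) ((y + b) ^ suc k))) ⟩
    k * (k ^ k * (y + b) ^ suc k) + k * x ^ suc k ∎))
    where
    open ≤-Reasoning
    x = suc k * y
    lhs : ∀ k p q → k * (suc k * p * (b * q)) + k * (suc k * y * (p * q)) ≡ suc k * (k * (y + b) * (p * q))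
    lhs k p q = solve (k ∷ p ∷ q ∷ y ∷ b ∷ [])

  -- One copy of `b` is adjoined at a time, and `mean-step` passes from the mean of k numbers to
  -- that of k + 1. The factor `(v + w) ^ (v + w)` is the denominator of the mean.
  weighted-AM-GM : ∀ v w a b → a ^ v * b ^ w * (v + w) ^ (v + w) ≤ (v * a + w * b) ^ (v + w)
  weighted-AM-GM v zero a b rewrite +-identityʳ v | +-identityʳ (v * a) | *-identityʳ (a ^ v) | ^-distribʳ-* v v a =
    ≤-reflexive (*-comm (a ^ v) (v ^ v))
  weighted-AM-GM v (suc w) a b rewrite +-suc v w = *-cancelˡ-≤ (k ^ k) {{n^n≢0 k}} (begin
    k ^ k * (a ^ v * (b * b ^ w) * suc k ^ suc k)  ≡⟨ rearrange (k ^ k) (a ^ v) (b ^ w) (suc k ^ suc k) ⟩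
    suc k ^ suc k * (b * (a ^ v * b ^ w * k ^ k))  ≤⟨ *-monoʳ-≤ (suc k ^ suc k) (*-monoʳ-≤ b (weighted-AM-GM v w a b)) ⟩
    suc k ^ suc k * (b * (v * a + w * b) ^ k)      ≤⟨ mean-step k (v * a + w * b) b ⟩
    k ^ k * (v * a + w * b + b) ^ suc k            ≡⟨ cong (λ t → k ^ k * t ^ suc k) total ⟩
    k ^ k * (v * a + suc w * b) ^ suc k            ∎)
    where
    open ≤-Reasoning
    k = v + w
    total : v * a + w * b + b ≡ v * a + suc w * b
    total = solve (v ∷ a ∷ w ∷ b ∷ [])
    rearrange : ∀ e f g h → e * (f * (b * g) * h) ≡ h * (b * (f * g * e))
    rearrange e f g h = solve (b ∷ e ∷ f ∷ g ∷ h ∷ [])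

  AM-GM : ∀ v w {a b c} → v * a + w * b ≤ (v + w) * c → a ^ v * b ^ w ≤ c ^ (v + w)
  AM-GM v w {a} {b} {c} le = *-cancelʳ-≤ _ _ (k ^ k) {{n^n≢0 k}} (begin
    a ^ v * b ^ w * k ^ k  ≤⟨ weighted-AM-GM v w a b ⟩
    (v * a + w * b) ^ k    ≤⟨ ^-monoˡ-≤ k le ⟩
    (k * c) ^ k            ≡⟨ ^-distribʳ-* k k c ⟩
    k ^ k * c ^ k          ≡⟨ *-comm (k ^ k) (c ^ k) ⟩
    c ^ k * k ^ k          ∎)
    where
    open ≤-Reasoning
    k = v + w

  -- Reads (a/b)^v ≤ (c/b)^(v+w), from AM-GM for v copies of a/b and w copies of 1. It turns a
  -- linear inequality into a bound with the fractional exponent (v+w)/v.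
  AM-GM-ratio : ∀ v w {a b c} → v * a + w * b ≤ (v + w) * c → a ^ v * b ^ (v + w) ≤ b ^ v * c ^ (v + w)
  AM-GM-ratio v w {a} {b} {c} le = begin
    a ^ v * b ^ (v + w)      ≡⟨ cong (a ^ v *_) (^-distribˡ-+-* b v w) ⟩
    a ^ v * (b ^ v * b ^ w)  ≡⟨ x∙yz≈y∙xz (a ^ v) (b ^ v) (b ^ w) ⟩
    b ^ v * (a ^ v * b ^ w)  ≤⟨ *-monoʳ-≤ (b ^ v) (AM-GM v w le) ⟩
    b ^ v * c ^ (v + w)      ∎
    where open ≤-Reasoning

  -- Powers, factorials and binomial coefficients

  ^-cancelˡ-≤ : ∀ k .{{_ : NonZero k}} {x y} → x ^ k ≤ y ^ k → x ≤ y
  ^-cancelˡ-≤ k le = ≮⇒≥ λ y<x → <⇒≱ (^-monoˡ-< k y<x) le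

  -- With s = r + 1 and n = s + t, the r copies of n and t copies of 1 have mean exactly s.
  n^[s-1]≤s^[n-1] : ∀ r t → (suc r + t) ^ r ≤ suc r ^ (r + t)
  n^[s-1]≤s^[n-1] r t = begin
    (suc r + t) ^ r          ≡⟨ *-identityʳ _ ⟨
    (suc r + t) ^ r * 1      ≡⟨ cong ((suc r + t) ^ r *_) (^-zeroˡ t) ⟨
    (suc r + t) ^ r * 1 ^ t  ≤⟨ AM-GM r t {suc r + t} {1} {suc r} (≤-reflexive (solve (r ∷ t ∷ []))) ⟩
    suc r ^ (r + t)          ∎
    where open ≤-Reasoning

  -- The constant 4 is the value of (1 + 1/s)^(s+1) at s = 1, its maximum.
  [1+s]^[1+s]≤4*s^[1+s] : ∀ s .{{_ : NonZero s}} → suc s ^ suc s ≤ 4 * s ^ suc s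
  [1+s]^[1+s]≤4*s^[1+s] s@(suc r) = *-cancelˡ-≤ (2 ^ r) {{m^n≢0 2 r}} (begin
    2 ^ r * (x * (x * x ^ r))        ≡⟨ rearrange (2 ^ r) x (x ^ r) ⟩
    x ^ 2 * (2 ^ r * x ^ r)          ≡⟨ cong (x ^ 2 *_) (^-distribʳ-* r 2 x) ⟨
    -- Two copies of s + 1 and s - 1 copies of 2(s + 1) have mean exactly 2s. Of the factor 2^(s+1)
    -- on the right, 2^(s-1) cancels and 4 remains.
    x ^ 2 * (2 * x) ^ r              ≤⟨ AM-GM 2 r {x} {2 * x} {2 * s} (≤-reflexive (weights r)) ⟩
    (2 * s) ^ suc s                  ≡⟨ ^-distribʳ-* (suc s) 2 s ⟩
    2 * (2 * 2 ^ r) * s ^ suc s      ≡⟨ rearrange′ (2 ^ r) (s ^ suc s) ⟩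
    2 ^ r * (4 * s ^ suc s)          ∎)
    where
    open ≤-Reasoning
    x = suc s
    weights : ∀ r → 2 * suc (suc r) + r * (2 * suc (suc r)) ≡ (2 + r) * (2 * suc r)
    weights r = solve (r ∷ [])
    rearrange : ∀ p x y → p * (x * (x * y)) ≡ x * (x * 1) * (p * y)
    rearrange p x y = solve (p ∷ x ∷ y ∷ [])
    rearrange′ : ∀ p y → 2 * (2 * p) * y ≡ p * (4 * y)
    rearrange′ p y = solve (p ∷ y ∷ [])

  -- A crude Stirling bound with 4 in place of e. The value s = 1 is treated separately because the
  -- preceding bound starts from a nonzero s.
  s^s≤4^s*s! : ∀ s → s ^ s ≤ 4 ^ s * s !
  s^s≤4^s*s! zero          = ≤-refl
  s^s≤4^s*s! (suc zero)    = s≤s z≤n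
  s^s≤4^s*s! (suc s@(suc _)) = begin
    suc s ^ suc s              ≤⟨ [1+s]^[1+s]≤4*s^[1+s] s ⟩
    4 * (s * s ^ s)            ≤⟨ *-monoʳ-≤ 4 (*-mono-≤ (n≤1+n s) (s^s≤4^s*s! s)) ⟩
    4 * (suc s * (4 ^ s * s !)) ≡⟨ rearrange (suc s) (4 ^ s) (s !) ⟩
    4 * 4 ^ s * (suc s * s !)  ∎
    where
    open ≤-Reasoning
    rearrange : ∀ x p y → 4 * (x * (p * y)) ≡ 4 * p * (x * y)
    rearrange x p y = solve (x ∷ p ∷ y ∷ [])

  -- The identity (k + 1) C(n, k+1) = (n - k) C(n, k), with both sides moved so that no subtraction occurs.
  C-absorption : ∀ n k → suc k * (n C suc k) + k * (n C k) ≡ n * (n C k)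
  C-absorption zero    zero    = refl
  C-absorption zero    (suc k) = cong₂ _+_
    (trans (cong (suc (suc k) *_) (k>n⇒nCk≡0 {0} {suc (suc k)} (s≤s z≤n))) (*-zeroʳ (suc (suc k))))
    (trans (cong (suc k *_) (k>n⇒nCk≡0 {0} {suc k} (s≤s z≤n))) (*-zeroʳ (suc k)))
  C-absorption (suc n) zero    = trans (+-identityʳ _) (trans (*-identityˡ _) (trans (nC1≡n (suc n)) (sym (*-identityʳ (suc n)))))
  C-absorption (suc n) (suc k) rewrite sym (nCk+nC[k+1]≡[n+1]C[k+1] n (suc k)) | sym (nCk+nC[k+1]≡[n+1]C[k+1] n k) =
    step (n C k) (n C suc k) (n C suc (suc k)) (C-absorption n k) (C-absorption n (suc k))
    where
    open ≤-Reasoning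
    step : ∀ a b c → suc k * b + k * a ≡ n * a → suc (suc k) * c + suc k * b ≡ n * b →
           suc (suc k) * (b + c) + suc k * (a + b) ≡ suc n * (a + b)
    step a b c ih₁ ih₂ = begin-equality
      suc (suc k) * (b + c) + suc k * (a + b)
        ≡⟨ solve (k ∷ a ∷ b ∷ c ∷ []) ⟩
      (suc k * b + k * a) + (suc (suc k) * c + suc k * b) + (a + b)
        ≡⟨ cong (_+ (a + b)) (cong₂ _+_ ih₁ ih₂) ⟩
      n * a + n * b + (a + b)
        ≡⟨ solve (n ∷ a ∷ b ∷ []) ⟩
      suc n * (a + b) ∎

  C-column : ∀ n k → suc n * (n C k) + k * (suc n C k) ≡ suc n * (suc n C k)
  C-column n zero    = +-identityʳ _
  C-column n (suc k) rewrite sym (nCk+nC[k+1]≡[n+1]C[k+1] n k) =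
    step (n C k) (n C suc k) (C-absorption n k)
    where
    open ≤-Reasoning
    step : ∀ a b → suc k * b + k * a ≡ n * a → suc n * b + suc k * (a + b) ≡ suc n * (a + b)
    step a b ih = begin-equality
      suc n * b + suc k * (a + b)           ≡⟨ solve (k ∷ n ∷ a ∷ b ∷ []) ⟩
      suc n * b + a + (suc k * b + k * a)   ≡⟨ cong (suc n * b + a +_) ih ⟩
      suc n * b + a + n * a                 ≡⟨ solve (n ∷ a ∷ b ∷ []) ⟩
      suc n * (a + b)                       ∎

  [1+k]*nC[1+k]≡[n∸k]*nCk : ∀ n k → suc k * (n C suc k) ≡ (n ∸ k) * (n C k)
  [1+k]*nC[1+k]≡[n∸k]*nCk n k with ≤-total k n
  ... | inj₁ k≤n = +-cancelʳ-≡ (k * (n C k)) _ _ (trans (C-absorption n k)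
          (trans (cong (_* (n C k)) (sym (m∸n+n≡m k≤n))) (*-distribʳ-+ (n C k) (n ∸ k) k)))
  ... | inj₂ n≤k rewrite m≤n⇒m∸n≡0 n≤k | k>n⇒nCk≡0 {n} {suc k} (s≤s n≤k) = *-zeroʳ (suc k)

  [1+n]*nCk≡[1+n∸k]*[1+n]Ck : ∀ n {k} → k ≤ suc n → suc n * (n C k) ≡ (suc n ∸ k) * (suc n C k)
  [1+n]*nCk≡[1+n∸k]*[1+n]Ck n {k} k≤1+n = +-cancelʳ-≡ (k * (suc n C k)) _ _ (trans (C-column n k)
    (trans (cong (_* (suc n C k)) (sym (m∸n+n≡m k≤1+n))) (*-distribʳ-+ (suc n C k) (suc n ∸ k) k)))

  C-monoˡ-≤ : ∀ k {m n} → m ≤ n → m C k ≤ n C k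
  C-monoˡ-≤ zero    m≤n = ≤-refl
  C-monoˡ-≤ (suc k) {m} m≤n = go (≤⇒≤′ m≤n)
    where
    go : ∀ {n} → m ≤′ n → m C suc k ≤ n C suc k
    go ≤′-refl           = ≤-refl
    go (≤′-step {n} m≤n) = ≤-trans (go m≤n) (subst (n C suc k ≤_) (nCk+nC[k+1]≡[n+1]C[k+1] n k) (m≤n+m _ (n C k)))

  nCk≢0 : ∀ {n k} → k ≤ n → NonZero (n C k)
  nCk≢0 {n} {zero}  _ = _
  nCk≢0 {suc n} {suc k} (s≤s k≤n) = >-nonZero (≤-trans (>-nonZero⁻¹ (n C k) {{nCk≢0 k≤n}})
    (subst (n C k ≤_) (nCk+nC[k+1]≡[n+1]C[k+1] n k) (m≤m+n (n C k) (n C suc k))))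

  nCk*k!≤n^k : ∀ n k → (n C k) * k ! ≤ n ^ k
  nCk*k!≤n^k n zero    = ≤-refl
  nCk*k!≤n^k n (suc k) = begin
    (n C suc k) * (suc k * k !)    ≡⟨ rearrange (n C suc k) (suc k) (k !) ⟩
    suc k * (n C suc k) * k !      ≡⟨ cong (_* k !) ([1+k]*nC[1+k]≡[n∸k]*nCk n k) ⟩
    (n ∸ k) * (n C k) * k !        ≡⟨ *-assoc (n ∸ k) (n C k) (k !) ⟩
    (n ∸ k) * ((n C k) * k !)      ≤⟨ *-mono-≤ (m∸n≤m n k) (nCk*k!≤n^k n k) ⟩
    n * n ^ k                      ∎
    where
    open ≤-Reasoning
    rearrange : ∀ x y z → x * (y * z) ≡ y * x * z
    rearrange x y z = solve (x ∷ y ∷ z ∷ [])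

  -- The ratio C(n, k)/C(n+1, k) = (n+1-k)/(n+1) grows with n. On n + 2 nodes this is the negative
  -- correlation of the events that a random k-set avoids each of two given nodes.
  C-log-concave : ∀ n k → (n C k) * (suc (suc n) C k) ≤ (suc n C k) * (suc n C k)
  C-log-concave n k with ≤-<-connex k (suc n)
  ... | inj₂ 1+n<k rewrite k>n⇒nCk≡0 {n} {k} (<-trans (n<1+n n) 1+n<k) = z≤n
  ... | inj₁ k≤1+n with f , k+f≡1+n ← m≤n⇒∃[o]m+o≡n k≤1+n =
    step (n C k) (suc n C k) (suc (suc n) C k)
      (trans ([1+n]*nCk≡[1+n∸k]*[1+n]Ck n k≤1+n) (cong (_* (suc n C k)) (m∸k (suc n) k f k+f≡1+n)))
      (trans ([1+n]*nCk≡[1+n∸k]*[1+n]Ck (suc n) (m≤n⇒m≤1+n k≤1+n))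
        (cong (_* (suc (suc n) C k)) (m∸k (suc (suc n)) k (suc f) (trans (+-suc k f) (cong suc k+f≡1+n)))))
      (subst (f ≤_) k+f≡1+n (m≤n+m f k))
    where
    open ≤-Reasoning
    m∸k : ∀ m k f → k + f ≡ m → m ∸ k ≡ f
    m∸k m k f refl = m+n∸m≡n k f
    step : ∀ a b c → suc n * a ≡ f * b → suc (suc n) * b ≡ suc f * c → f ≤ suc n → a * c ≤ b * b
    step a b c eq₁ eq₂ f≤ = *-cancelˡ-≤ (suc n * suc f) (begin
      suc n * suc f * (a * c)        ≡⟨ solve (n ∷ f ∷ a ∷ c ∷ []) ⟩
      (suc n * a) * (suc f * c)      ≡⟨ cong₂ _*_ eq₁ (sym eq₂) ⟩
      f * b * (suc (suc n) * b)      ≡⟨ solve (n ∷ f ∷ b ∷ []) ⟩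
      (f + f * suc n) * (b * b)      ≤⟨ *-monoˡ-≤ (b * b) (+-monoˡ-≤ (f * suc n) f≤) ⟩
      (suc n + f * suc n) * (b * b)  ≡⟨ solve (n ∷ f ∷ b ∷ []) ⟩
      suc n * suc f * (b * b)        ∎)

  Rr[x+y]≡rxR+rRy : ∀ R r x y → R * (r * (x + y)) ≡ r * (x * R) + r * (R * y)
  Rr[x+y]≡rxR+rRy R r x y = solve (R ∷ r ∷ x ∷ y ∷ [])

  square-bound : ∀ A B x → 2 * (A * B) * x ≤ A * A + B * B * (x * x)
  square-bound A B x = subst₂ _≤_ (lhs A B x) (rhs A B x) (2xy≤x²+y² A (B * x))
    where
    lhs : ∀ A B x → 2 * (A * (B * x)) ≡ 2 * (A * B) * x
    lhs A B x = solve (A ∷ B ∷ x ∷ [])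
    rhs : ∀ A B x → A * A + B * x * (B * x) ≡ A * A + B * B * (x * x)
    rhs A B x = solve (A ∷ B ∷ x ∷ [])

  square-bound-at-0 : ∀ A B → 1 * (A * A) + 2 * (A * B) * 0 ≡ A * A + B * B * (0 * 0)
  square-bound-at-0 A B = solve (A ∷ B ∷ [])

  -- With `B` outcomes and `A` the total of a count X, the premise is Chebyshev's sum of (A - BX)²
  -- multiplied out. Negative correlation, `B * D ≤ U * U`, bounds the pair term by `B * (A * A)`,
  -- so all terms in BA² cancel and only the diagonal `B * B * A` survives. Division by `A` leaves
  -- c/B ≤ B/A, the reciprocal of the mean.
  Chebyshev-cancel : ∀ c A B ν D U → A ≡ ν * U → B * D ≤ U * U →
    c * (A * A) + 2 * (A * B) * A ≤ B * (A * A) + B * B * (A + ν * (ν * D)) → c * A ≤ B * B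
  Chebyshev-cancel c zero      B ν D U _    _      _  rewrite *-zeroʳ c = z≤n
  Chebyshev-cancel c A@(suc _) B ν D U A≡νU BD≤UU le = *-cancelʳ-≤ _ _ A (+-cancelʳ-≤ (2 * (A * B) * A) _ _ (begin
    c * A * A + 2 * (A * B) * A                       ≡⟨ cong (_+ 2 * (A * B) * A) (*-assoc c A A) ⟩
    c * (A * A) + 2 * (A * B) * A                     ≤⟨ le ⟩
    B * (A * A) + B * B * (A + ν * (ν * D))           ≡⟨ expand A B ν D ⟩
    B * (A * A) + B * B * A + B * (ν * ν * (B * D))   ≤⟨ +-monoʳ-≤ _ (*-monoʳ-≤ B (*-monoʳ-≤ (ν * ν) BD≤UU)) ⟩
    B * (A * A) + B * B * A + B * (ν * ν * (U * U))
      ≡⟨ cong (λ x → B * (A * A) + B * B * A + B * x) (trans ([m*n]*[o*p]≡[m*o]*[n*p] ν ν U U) (cong₂ _*_ (sym A≡νU) (sym A≡νU))) ⟩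
    B * (A * A) + B * B * A + B * (A * A)             ≡⟨ collect A B ⟩
    B * B * A + 2 * (A * B) * A                       ∎))
    where
    open ≤-Reasoning
    expand : ∀ A B ν D → B * (A * A) + B * B * (A + ν * (ν * D)) ≡ B * (A * A) + B * B * A + B * (ν * ν * (B * D))
    expand A B ν D = solve (A ∷ B ∷ ν ∷ D ∷ [])
    collect : ∀ A B → B * (A * A) + B * B * A + B * (A * A) ≡ B * B * A + 2 * (A * B) * A
    collect A B = solve (A ∷ B ∷ [])

  -- The probability that a random d-set lies on one side of a cut of sizes s = σ + 1 ≤ t = τ + 1
  -- is at most (1 - d/n) ^ (st / (n - 1)), where n = s + t.
  module Cut (σ τ : ℕ) (σ≤τ : σ ≤ τ) where

    s t n v u : ℕ
    s = suc σ
    t = suc τ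
    n = s + t
    v = σ + t
    u = s * t

    uncut : ℕ → ℕ
    uncut d = (s C d) + (t C d)

    -- That is, st = (n - 1) + (s - 1)(t - 1): the exponent `u` splits into the weights `v` and
    -- `σ * τ` needed for `AM-GM-ratio`.
    v+στ≡u : (σ + suc τ) + σ * τ ≡ suc σ * suc τ
    v+στ≡u = solve (σ ∷ τ ∷ [])

    private
      AM-GM-uv : ∀ {a b c} → v * a + σ * τ * b ≤ u * c → a ^ v * b ^ u ≤ b ^ v * c ^ u
      AM-GM-uv {a} {b} {c} le =
        subst (λ k → a ^ v * b ^ k ≤ b ^ v * c ^ k) v+στ≡u
          (AM-GM-ratio v (σ * τ) (subst (λ k → v * a + σ * τ * b ≤ k * c) (sym v+στ≡u) le))

      2*[1+k]C2≡[1+k]*k : ∀ k → 2 * (suc k C 2) ≡ suc k * k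
      2*[1+k]C2≡[1+k]*k k = trans ([1+k]*nC[1+k]≡[n∸k]*nCk (suc k) 1)
        (trans (cong (k *_) (nC1≡n (suc k))) (*-comm k (suc k)))

      instance
        v≢0 : NonZero v
        v≢0 = >-nonZero (≤-trans (s≤s z≤n) (m≤n+m t σ))

      -- A pair is cut with probability 2u/(nv), so this is 1 - (u/v)(2/n) ≤ (1 - 2/n)^(u/v), with
      -- both fractions cleared of the denominators of C(·, 2). The induction starts at d = 2
      -- because a singleton is never cut, so the bound fails at d = 1.
      base : uncut 2 ^ v * n ^ u ≤ (n C 2) ^ v * (n ∸ 2) ^ u
      base = *-cancelˡ-≤ (2 ^ v * v ^ u) {{m*n≢0 (2 ^ v) (v ^ u) {{m^n≢0 2 v}} {{m^n≢0 v u}}}} (begin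
        2 ^ v * v ^ u * (uncut 2 ^ v * n ^ u)
          ≡⟨ rearrange (2 ^ v) (v ^ u) (uncut 2 ^ v) (n ^ u) ⟩
        2 ^ v * uncut 2 ^ v * (n ^ u * v ^ u)
          ≡⟨ cong₂ _*_ (^-distribʳ-* v 2 (uncut 2)) (^-distribʳ-* u n v) ⟨
        (2 * uncut 2) ^ v * (n * v) ^ u
          ≡⟨ cong (λ x → x ^ v * (n * v) ^ u) 2uncut ⟩
        (s * σ + t * τ) ^ v * (n * v) ^ u
          ≤⟨ AM-GM-uv {s * σ + t * τ} {n * v} {(σ + τ) * v} (≤-reflexive (weights σ τ)) ⟩
        (n * v) ^ v * ((σ + τ) * v) ^ u
          ≡⟨ cong₂ (λ x y → x ^ v * y ^ u) (sym (2*[1+k]C2≡[1+k]*k v)) (cong (λ y → (y ∸ 1) * v) (sym (+-suc σ τ))) ⟩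
        (2 * (n C 2)) ^ v * ((n ∸ 2) * v) ^ u
          ≡⟨ cong₂ _*_ (^-distribʳ-* v 2 (n C 2)) (^-distribʳ-* u (n ∸ 2) v) ⟩
        2 ^ v * (n C 2) ^ v * ((n ∸ 2) ^ u * v ^ u)
          ≡⟨ rearrange (2 ^ v) (v ^ u) ((n C 2) ^ v) ((n ∸ 2) ^ u) ⟨
        2 ^ v * v ^ u * ((n C 2) ^ v * (n ∸ 2) ^ u) ∎)
        where
        open ≤-Reasoning
        rearrange : ∀ x y z w → x * y * (z * w) ≡ x * z * (w * y)
        rearrange x y z w = solve (x ∷ y ∷ z ∷ w ∷ [])
        weights : ∀ σ τ → (σ + suc τ) * (suc σ * σ + suc τ * τ) + σ * τ * ((suc σ + suc τ) * (σ + suc τ)) ≡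
                          suc σ * suc τ * ((σ + τ) * (σ + suc τ))
        weights σ τ = solve (σ ∷ τ ∷ [])
        2uncut : 2 * uncut 2 ≡ s * σ + t * τ
        2uncut = trans (*-distribˡ-+ 2 (s C 2) (t C 2)) (cong₂ _+_ (2*[1+k]C2≡[1+k]*k σ) (2*[1+k]C2≡[1+k]*k τ))

      -- If d chosen elements lie on one side, a further one stays there with probability at most (t
      -- - d)/(n - d), `t` being the larger side.
      uncut-suc : ∀ d → uncut (suc d) * ((n C d) * (n ∸ d)) ≤ (t ∸ d) * (uncut d * (n C suc d))
      uncut-suc d = *-cancelˡ-≤ (suc d) (begin
        suc d * (uncut (suc d) * ((n C d) * (n ∸ d)))
          ≡⟨ *-assoc (suc d) (uncut (suc d)) _ ⟨
        suc d * uncut (suc d) * ((n C d) * (n ∸ d))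
          ≤⟨ *-monoˡ-≤ _ (≤-trans (≤-reflexive (trans (*-distribˡ-+ (suc d) (s C suc d) (t C suc d))
               (cong₂ _+_ ([1+k]*nC[1+k]≡[n∸k]*nCk s d) ([1+k]*nC[1+k]≡[n∸k]*nCk t d))))
               (+-monoˡ-≤ _ (*-monoˡ-≤ (s C d) (∸-monoˡ-≤ d (s≤s σ≤τ))))) ⟩
        ((t ∸ d) * (s C d) + (t ∸ d) * (t C d)) * ((n C d) * (n ∸ d))
          ≡⟨ rearrange (t ∸ d) (s C d) (t C d) (n C d) (n ∸ d) ⟩
        (t ∸ d) * (uncut d * ((n ∸ d) * (n C d)))
          ≡⟨ cong (λ x → (t ∸ d) * (uncut d * x)) ([1+k]*nC[1+k]≡[n∸k]*nCk n d) ⟨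
        (t ∸ d) * (uncut d * (suc d * (n C suc d)))
          ≡⟨ rearrange′ (t ∸ d) (uncut d) (suc d) (n C suc d) ⟩
        suc d * ((t ∸ d) * (uncut d * (n C suc d))) ∎)
        where
        open ≤-Reasoning
        rearrange : ∀ x a b y z → (x * a + x * b) * (y * z) ≡ x * ((a + b) * (z * y))
        rearrange x a b y z = solve (x ∷ a ∷ b ∷ y ∷ z ∷ [])
        rearrange′ : ∀ x y z w → x * (y * (z * w)) ≡ z * (x * (y * w))
        rearrange′ x y z w = solve (x ∷ y ∷ z ∷ w ∷ [])

      -- Compares the growth factor (t - d)/(n - d) of the left side of the bound with the factor
      -- ((n-d-1)/(n-d))^(u/v) of its right side. AM-GM applies with slack `σ * s`.
      factor : ∀ d → (t ∸ d) ^ v * (n ∸ d) ^ u ≤ (n ∸ d) ^ v * (n ∸ suc d) ^ u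
      factor d with ≤-total t d
      ... | inj₁ t≤d rewrite m≤n⇒m∸n≡0 t≤d =
        -- The left side vanishes once d ≥ t; `v` is rewritten as a successor so that `0 ^ v`
        -- computes to 0.
        subst (λ k → 0 ^ k * (n ∸ d) ^ u ≤ (n ∸ d) ^ k * (n ∸ suc d) ^ u) (sym (+-suc σ τ)) z≤n
      ... | inj₂ d≤t = subst₂ (λ x y → f ^ v * x ^ u ≤ x ^ v * y ^ u) (sym (+-∸-assoc s d≤t)) (sym (+-∸-assoc σ d≤t))
        (AM-GM-uv {f} {s + f} {σ + f} (begin
          v * f + σ * τ * (s + f)            ≤⟨ m≤m+n _ (σ * s) ⟩
          v * f + σ * τ * (s + f) + σ * s    ≡⟨ weights σ τ f ⟩
          u * (σ + f)                        ∎))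
        where
        open ≤-Reasoning
        f = t ∸ d
        weights : ∀ σ τ f → (σ + suc τ) * f + σ * τ * (suc σ + f) + σ * suc σ ≡ suc σ * suc τ * (σ + f)
        weights σ τ f = solve (σ ∷ τ ∷ f ∷ [])

      step : ∀ d → d < n → uncut d ^ v * n ^ u ≤ (n C d) ^ v * (n ∸ d) ^ u →
             uncut (suc d) ^ v * n ^ u ≤ (n C suc d) ^ v * (n ∸ suc d) ^ u
      step d d<n ih = *-cancelˡ-≤ (N ^ v * e ^ v * e ^ u) {{m*n≢0 (N ^ v * e ^ v) (e ^ u) {{m*n≢0 (N ^ v) (e ^ v)}}}} (begin
        N ^ v * e ^ v * e ^ u * (P′ ^ v * n ^ u)
          ≡⟨ rearrange (N ^ v) (e ^ v) (e ^ u) (P′ ^ v) (n ^ u) ⟩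
        P′ ^ v * (N ^ v * e ^ v) * (n ^ u * e ^ u)
          ≡⟨ cong (_* (n ^ u * e ^ u)) (trans (^-distribʳ-* v P′ (N * e)) (cong (P′ ^ v *_) (^-distribʳ-* v N e))) ⟨
        (P′ * (N * e)) ^ v * (n ^ u * e ^ u)
          ≤⟨ *-monoˡ-≤ (n ^ u * e ^ u) (^-monoˡ-≤ v (uncut-suc d)) ⟩
        (a * (P * N′)) ^ v * (n ^ u * e ^ u)
          ≡⟨ cong (_* (n ^ u * e ^ u)) (trans (^-distribʳ-* v a (P * N′)) (cong (a ^ v *_) (^-distribʳ-* v P N′))) ⟩
        a ^ v * (P ^ v * N′ ^ v) * (n ^ u * e ^ u)
          ≡⟨ rearrange′ (a ^ v) (P ^ v) (N′ ^ v) (n ^ u) (e ^ u) ⟩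
        a ^ v * e ^ u * (P ^ v * n ^ u) * N′ ^ v
          ≤⟨ *-monoˡ-≤ (N′ ^ v) (*-mono-≤ (factor d) ih) ⟩
        e ^ v * (n ∸ suc d) ^ u * (N ^ v * e ^ u) * N′ ^ v
          ≡⟨ rearrange″ (e ^ v) ((n ∸ suc d) ^ u) (N ^ v) (e ^ u) (N′ ^ v) ⟩
        N ^ v * e ^ v * e ^ u * (N′ ^ v * (n ∸ suc d) ^ u) ∎)
        where
        open ≤-Reasoning
        P = uncut d
        P′ = uncut (suc d)
        N = n C d
        N′ = n C suc d
        e = n ∸ d
        a = t ∸ d
        instance
          e≢0 : NonZero e
          e≢0 = >-nonZero (m<n⇒0<n∸m d<n)
          N≢0 : NonZero N
          N≢0 = nCk≢0 (<⇒≤ d<n)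
          ev≢0 : NonZero (e ^ v)
          ev≢0 = m^n≢0 e v
          eu≢0 : NonZero (e ^ u)
          eu≢0 = m^n≢0 e u
          Nv≢0 : NonZero (N ^ v)
          Nv≢0 = m^n≢0 N v
        rearrange : ∀ x y z p w → x * y * z * (p * w) ≡ p * (x * y) * (w * z)
        rearrange x y z p w = solve (x ∷ y ∷ z ∷ p ∷ w ∷ [])
        rearrange′ : ∀ x y z w p → x * (y * z) * (w * p) ≡ x * p * (y * w) * z
        rearrange′ x y z w p = solve (x ∷ y ∷ z ∷ w ∷ p ∷ [])
        rearrange″ : ∀ x y z w p → x * y * (z * w) * p ≡ z * x * w * (p * y)
        rearrange″ x y z w p = solve (x ∷ y ∷ z ∷ w ∷ p ∷ [])

    uncut-bound : ∀ {d} → 2 ≤ d → d ≤ n → uncut d ^ v * n ^ u ≤ (n C d) ^ v * (n ∸ d) ^ u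
    uncut-bound 2≤d = go (≤⇒≤′ 2≤d)
      where
      go : ∀ {d} → 2 ≤′ d → d ≤ n → uncut d ^ v * n ^ u ≤ (n C d) ^ v * (n ∸ d) ^ u
      go ≤′-refl             _   = base
      go (≤′-step {d} 2≤′d) d<n = step d d<n (go 2≤′d (<⇒≤ d<n))

    -- Of the exponent sv of n, the part `u` is kept, to be paired with the exponent of q^m in
    -- `uncut-bound`. The rest, s(s - 1), is traded for s^(sv), which the factorial absorbs up to
    -- 4^(sv).
    nCs-bound : (n C s) ^ v ≤ n ^ u * 4 ^ (s * v)
    nCs-bound = *-cancelʳ-≤ _ _ ((s !) ^ v) {{m^n≢0 (s !) v {{s !≢0}}}} (begin
      (n C s) ^ v * (s !) ^ v                 ≡⟨ ^-distribʳ-* v (n C s) (s !) ⟨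
      ((n C s) * s !) ^ v                   ≤⟨ ^-monoˡ-≤ v (nCk*k!≤n^k n s) ⟩
      (n ^ s) ^ v                           ≡⟨ ^-*-assoc n s v ⟩
      n ^ (s * v)                           ≡⟨ cong (n ^_) exponent ⟩
      n ^ (u + σ * s)                       ≡⟨ ^-distribˡ-+-* n u (σ * s) ⟩
      n ^ u * n ^ (σ * s)                   ≡⟨ cong (n ^ u *_) (^-*-assoc n σ s) ⟨
      n ^ u * (n ^ σ) ^ s                   ≤⟨ *-monoʳ-≤ (n ^ u) (^-monoˡ-≤ s (n^[s-1]≤s^[n-1] σ t)) ⟩
      n ^ u * (s ^ v) ^ s                   ≡⟨ cong (n ^ u *_) (^-swap s v s) ⟩
      n ^ u * (s ^ s) ^ v                   ≤⟨ *-monoʳ-≤ (n ^ u) (^-monoˡ-≤ v (s^s≤4^s*s! s)) ⟩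
      n ^ u * (4 ^ s * s !) ^ v
        ≡⟨ cong (n ^ u *_) (trans (^-distribʳ-* v (4 ^ s) (s !)) (cong (_* (s !) ^ v) (^-*-assoc 4 s v))) ⟩
      n ^ u * (4 ^ (s * v) * (s !) ^ v)       ≡⟨ *-assoc (n ^ u) _ _ ⟨
      n ^ u * 4 ^ (s * v) * (s !) ^ v         ∎)
      where
      open ≤-Reasoning
      exponent : suc σ * (σ + suc τ) ≡ suc σ * suc τ + σ * suc σ
      exponent = solve (σ ∷ τ ∷ [])

    -- The expected number of sets of size s cut by none of V₁, …, V_m is at most R ^ (- s).
    expected-uncut : ∀ m {d} R .{{_ : NonZero R}} → 2 ≤ d → d ≤ n →
      (4 * R) ^ 2 * n * (n ∸ d) ^ m ≤ n ^ m → (n C s) * uncut d ^ m * R ^ s ≤ (n C d) ^ m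
    expected-uncut m {d} R 2≤d d≤n hyp = ^-cancelˡ-≤ v (begin
      ((n C s) * P ^ m * R ^ s) ^ v
        ≡⟨ trans (^-distribʳ-* v ((n C s) * P ^ m) (R ^ s)) (cong₂ _*_ (^-distribʳ-* v (n C s) (P ^ m)) (^-*-assoc R s v)) ⟩
      (n C s) ^ v * (P ^ m) ^ v * R ^ (s * v)
        ≤⟨ *-monoˡ-≤ _ (*-monoˡ-≤ _ nCs-bound) ⟩
      n ^ u * 4 ^ (s * v) * (P ^ m) ^ v * R ^ (s * v)
        ≡⟨ rearrange (n ^ u) (4 ^ (s * v)) ((P ^ m) ^ v) (R ^ (s * v)) ⟩
      (P ^ m) ^ v * (4 ^ (s * v) * R ^ (s * v) * n ^ u)
        ≡⟨ cong (λ x → (P ^ m) ^ v * (x * n ^ u)) (^-distribʳ-* (s * v) 4 R) ⟨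
      (P ^ m) ^ v * ((4 * R) ^ (s * v) * n ^ u)
        ≤⟨ *-monoʳ-≤ ((P ^ m) ^ v) (*-monoˡ-≤ (n ^ u) (^-monoʳ-≤ (4 * R) {{m*n≢0 4 R}} sv≤2u)) ⟩
      (P ^ m) ^ v * ((4 * R) ^ (2 * u) * n ^ u)
        ≡⟨ cong ((P ^ m) ^ v *_) (trans (^-distribʳ-* u ((4 * R) ^ 2) n) (cong (_* n ^ u) (^-*-assoc (4 * R) 2 u))) ⟨
      (P ^ m) ^ v * K ^ u
        ≤⟨ *-cancelʳ-≤ _ _ ((n ^ m) ^ u) {{m^n≢0 (n ^ m) u {{m^n≢0 n m}}}} uncut-power ⟩
      (N ^ m) ^ v ∎)
      where
      open ≤-Reasoning
      P = uncut d
      N = n C d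
      K = (4 * R) ^ 2 * n
      double : ∀ s t → s * (t + t) ≡ 2 * (s * t)
      double s t = solve (s ∷ t ∷ [])
      -- As n - 1 ≤ 2t, the factor (4R)^(sv) is at most ((4R)^2)^u. This is why the hypothesis has
      -- the square of `4 * R`.
      sv≤2u : s * v ≤ 2 * u
      sv≤2u = ≤-trans (*-monoʳ-≤ s (+-monoˡ-≤ t (m≤n⇒m≤1+n σ≤τ))) (≤-reflexive (double s t))
      rearrange : ∀ x y z w → x * y * z * w ≡ z * (y * w * x)
      rearrange x y z w = solve (x ∷ y ∷ z ∷ w ∷ [])
      rearrange′ : ∀ x y z → x * y * z ≡ x * z * y
      rearrange′ x y z = solve (x ∷ y ∷ z ∷ [])
      uncut-power : (P ^ m) ^ v * K ^ u * (n ^ m) ^ u ≤ (N ^ m) ^ v * (n ^ m) ^ u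
      uncut-power = begin
        (P ^ m) ^ v * K ^ u * (n ^ m) ^ u          ≡⟨ rearrange′ ((P ^ m) ^ v) (K ^ u) ((n ^ m) ^ u) ⟩
        (P ^ m) ^ v * (n ^ m) ^ u * K ^ u
          ≡⟨ cong (_* K ^ u) (trans (^-distribʳ-* m (P ^ v) (n ^ u)) (cong₂ _*_ (^-swap P v m) (^-swap n u m))) ⟨
        (P ^ v * n ^ u) ^ m * K ^ u                ≤⟨ *-monoˡ-≤ (K ^ u) (^-monoˡ-≤ m (uncut-bound 2≤d d≤n)) ⟩
        (N ^ v * (n ∸ d) ^ u) ^ m * K ^ u
          ≡⟨ cong (_* K ^ u) (trans (^-distribʳ-* m (N ^ v) ((n ∸ d) ^ u)) (cong₂ _*_ (^-swap N v m) (^-swap (n ∸ d) u m))) ⟩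
        (N ^ m) ^ v * ((n ∸ d) ^ m) ^ u * K ^ u
          ≡⟨ trans (*-assoc ((N ^ m) ^ v) _ _) (cong ((N ^ m) ^ v *_) (trans (*-comm (((n ∸ d) ^ m) ^ u) (K ^ u)) (sym (^-distribʳ-* u K ((n ∸ d) ^ m))))) ⟩
        (N ^ m) ^ v * (K * (n ∸ d) ^ m) ^ u        ≤⟨ *-monoʳ-≤ ((N ^ m) ^ v) (^-monoˡ-≤ u hyp) ⟩
        (N ^ m) ^ v * (n ^ m) ^ u                  ∎

  expected-uncut′ : ∀ n m d R .{{_ : NonZero R}} σ → let s = suc σ in 2 ≤ d → d ≤ n → s + s ≤ n →
    (4 * R) ^ 2 * n * (n ∸ d) ^ m ≤ n ^ m → (n C s) * ((s C d) + ((n ∸ s) C d)) ^ m * R ^ s ≤ (n C d) ^ m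
  expected-uncut′ n m d R σ 2≤d d≤n 2s≤n hyp with o , s+s+o≡n ← m≤n⇒∃[o]m+o≡n 2s≤n =
    go n (σ + o) (m≤m+n σ o) (trans (sym s+s+o≡n) (+-assoc (suc σ) (suc σ) o)) d≤n hyp
    where
    go : ∀ n τ → σ ≤ τ → n ≡ suc σ + suc τ → d ≤ n → (4 * R) ^ 2 * n * (n ∸ d) ^ m ≤ n ^ m →
         (n C suc σ) * ((suc σ C d) + ((n ∸ suc σ) C d)) ^ m * R ^ suc σ ≤ (n C d) ^ m
    go n τ σ≤τ refl d≤n hyp =
      subst (λ t → (n C suc σ) * ((suc σ C d) + (t C d)) ^ m * R ^ suc σ ≤ (n C d) ^ m) (sym (m+n∸m≡n σ (suc τ)))
        (Cut.expected-uncut σ τ σ≤τ m R 2≤d d≤n hyp)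

-- Finite sums and counting of tuples of d-sets

module Counting where

  open import Data.Bool using (if_then_else_; true; false)
  open import Data.Fin using (Fin; zero; suc)
  import Data.Fin.Properties as Fin
  open import Data.Fin.Subset using (Subset; inside; outside; _∈_; _∉_; _⊆_; ∣_∣; ⊤; ⁅_⁆; ∁; _-_)
  open import Data.Fin.Subset.Properties
  open import Data.List using (List; []; _∷_; [_]; _++_; map; filter; length; allFin; upTo; cartesianProductWith)
  open import Data.List.Membership.Propositional using () renaming (_∈_ to _∈ˡ_)
  open import Data.List.Membership.Propositional.Properties using (∈-map⁺; ∈-++⁺ˡ; ∈-++⁺ʳ; ∈-filter⁺; ∈-filter⁻; ∈-upTo⁺)
  open import Data.List.Properties using (map-upTo; map-tabulate; length-tabulate)
  open import Data.List.Relation.Unary.Any using (here; there)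
  open import Data.Nat using (ℕ; zero; suc; _+_; _*_; _∸_; _^_; _≤_; z≤n; s≤s; s≤s⁻¹)
  import Data.Nat as ℕ
  open import Data.Nat.Combinatorics using (_C_; k>n⇒nCk≡0; nCk+nC[k+1]≡[n+1]C[k+1])
  open import Data.Nat.ListAction using (sum)
  open import Data.Nat.Properties
  open import Algebra.Properties.CommutativeSemigroup *-commutativeSemigroup using (xy∙z≈y∙xz)
  open import Algebra.Properties.CommutativeSemigroup +-commutativeSemigroup using (interchange)
  open import Data.Product using (_×_; _,_; proj₂; ∃-syntax)
  open import Data.Sum using (_⊎_; inj₁; inj₂)
  open import Data.Vec using (Vec; []; _∷_; lookup)
  import Data.Vec as Vec
  open import Data.Vec.Properties using ([]=⇒lookup; lookup⇒[]=; lookup∘tabulate)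
  open import Function using (_∘_; id)
  open import Function.Bundles using (mk⇔)
  open import Level using (0ℓ)
  open import Relation.Binary.Construct.Closure.ReflexiveTransitive using (Star; ε; _◅_; _◅◅_)
  open import Relation.Binary.PropositionalEquality using (_≡_; _≢_; refl; sym; trans; cong; cong₂; subst; module ≡-Reasoning)
  open import Relation.Nullary using (Dec; yes; no; does; ¬_; contradiction)
  open import Relation.Nullary.Decidable using (dec-true; dec-false; decidable-stable; ¬¬-excluded-middle; does-⇔)
  open import Relation.Unary using (Pred; Decidable)
  open import Defs
  open Arithmetic

  private
    variable
      A B E : Set
      P Q : Set

  ∑ : List A → (A → ℕ) → ℕ
  ∑ xs f = sum (map f xs)

  𝟙 : Dec P → ℕ
  𝟙 P? = if does P? then 1 else 0

  𝟙≤1 : (P? : Dec P) → 𝟙 P? ≤ 1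
  𝟙≤1 (yes _) = ≤-refl
  𝟙≤1 (no _)  = z≤n

  𝟙-true : (P? : Dec P) → P → 𝟙 P? ≡ 1
  𝟙-true P? p rewrite dec-true P? p = refl

  𝟙-false : (P? : Dec P) → ¬ P → 𝟙 P? ≡ 0
  𝟙-false P? ¬p rewrite dec-false P? ¬p = refl

  𝟙-⇔ : (P? : Dec P) (Q? : Dec Q) → (P → Q) → (Q → P) → 𝟙 P? ≡ 𝟙 Q?
  𝟙-⇔ P? Q? to from = cong (if_then 1 else 0) (does-⇔ (mk⇔ to from) P? Q?)

  ∑-mono-∈ : ∀ (xs : List A) {f g} → (∀ {x} → x ∈ˡ xs → f x ≤ g x) → ∑ xs f ≤ ∑ xs g
  ∑-mono-∈ []       f≤g = z≤n
  ∑-mono-∈ (x ∷ xs) f≤g = +-mono-≤ (f≤g (here refl)) (∑-mono-∈ xs (f≤g ∘ there))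

  ∑-mono : ∀ (xs : List A) {f g} → (∀ x → f x ≤ g x) → ∑ xs f ≤ ∑ xs g
  ∑-mono xs f≤g = ∑-mono-∈ xs λ {x} _ → f≤g x

  ∑-cong : ∀ (xs : List A) {f g} → (∀ x → f x ≡ g x) → ∑ xs f ≡ ∑ xs g
  ∑-cong []       f≡g = refl
  ∑-cong (x ∷ xs) f≡g = cong₂ _+_ (f≡g x) (∑-cong xs f≡g)

  ∑-+ : ∀ (xs : List A) f g → ∑ xs (λ x → f x + g x) ≡ ∑ xs f + ∑ xs g
  ∑-+ []       f g = refl
  ∑-+ (x ∷ xs) f g rewrite ∑-+ xs f g = interchange (f x) (g x) (∑ xs f) (∑ xs g)

  ∑-*ˡ : ∀ (xs : List A) c f → ∑ xs (λ x → c * f x) ≡ c * ∑ xs f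
  ∑-*ˡ []       c f = sym (*-zeroʳ c)
  ∑-*ˡ (x ∷ xs) c f rewrite ∑-*ˡ xs c f = sym (*-distribˡ-+ c (f x) (∑ xs f))

  ∑-*ʳ : ∀ (xs : List A) c f → ∑ xs (λ x → f x * c) ≡ ∑ xs f * c
  ∑-*ʳ xs c f = trans (∑-cong xs λ x → *-comm (f x) c) (trans (∑-*ˡ xs c f) (*-comm c _))

  ∑-const : ∀ (xs : List A) c → ∑ xs (λ _ → c) ≡ length xs * c
  ∑-const []       c = refl
  ∑-const (x ∷ xs) c = cong (c +_) (∑-const xs c)

  ∑-0 : ∀ (xs : List A) {f} → (∀ x → f x ≡ 0) → ∑ xs f ≡ 0
  ∑-0 xs f≡0 = trans (∑-cong xs f≡0) (trans (∑-const xs 0) (*-zeroʳ (length xs)))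

  ∑-1 : ∀ (xs : List A) → ∑ xs (λ _ → 1) ≡ length xs
  ∑-1 xs = trans (∑-const xs 1) (*-identityʳ (length xs))

  ∑-swap : ∀ (xs : List A) (ys : List B) (f : A → B → ℕ) → ∑ xs (λ x → ∑ ys (f x)) ≡ ∑ ys (λ y → ∑ xs (λ x → f x y))
  ∑-swap []       ys f = sym (∑-0 ys λ _ → refl)
  ∑-swap (x ∷ xs) ys f rewrite ∑-swap xs ys f = sym (∑-+ ys (f x) (λ y → ∑ xs (λ x → f x y)))

  ∑-* : ∀ (xs : List A) (ys : List B) f g → ∑ xs f * ∑ ys g ≡ ∑ xs (λ x → ∑ ys (λ y → f x * g y))
  ∑-* xs ys f g = sym (trans (∑-cong xs λ x → ∑-*ˡ ys (f x) g) (∑-*ʳ xs (∑ ys g) f))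

  ∑-++ : ∀ (xs ys : List A) f → ∑ (xs ++ ys) f ≡ ∑ xs f + ∑ ys f
  ∑-++ []       ys f = refl
  ∑-++ (x ∷ xs) ys f rewrite ∑-++ xs ys f = sym (+-assoc (f x) _ _)

  ∑-map : ∀ (g : A → B) xs f → ∑ (map g xs) f ≡ ∑ xs (f ∘ g)
  ∑-map g []       f = refl
  ∑-map g (x ∷ xs) f = cong (f (g x) +_) (∑-map g xs f)

  ∑-∈ : ∀ {xs : List A} f {x} → x ∈ˡ xs → f x ≤ ∑ xs f
  ∑-∈ f (here refl) = m≤m+n _ _
  ∑-∈ f (there x∈)  = ≤-trans (∑-∈ f x∈) (m≤n+m _ _)

  ∑-filter : ∀ {R : Pred A 0ℓ} (R? : Decidable R) xs f → ∑ (filter R? xs) f ≡ ∑ xs (λ x → 𝟙 (R? x) * f x)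
  ∑-filter R? []       f = refl
  ∑-filter R? (x ∷ xs) f with does (R? x)
  ... | true  = cong₂ _+_ (sym (+-identityʳ (f x))) (∑-filter R? xs f)
  ... | false = ∑-filter R? xs f

  ∑-cartesianProductWith : ∀ (g : A → B → E) xs ys f →
    ∑ (cartesianProductWith g xs ys) f ≡ ∑ xs (λ x → ∑ ys (λ y → f (g x y)))
  ∑-cartesianProductWith g []       ys f = refl
  ∑-cartesianProductWith g (x ∷ xs) ys f =
    trans (∑-++ (map (g x) ys) _ f) (cong₂ _+_ (∑-map (g x) ys f) (∑-cartesianProductWith g xs ys f))

  ∑-upTo-suc : ∀ k f → ∑ (upTo (suc k)) f ≡ f 0 + ∑ (upTo k) (f ∘ suc)
  ∑-upTo-suc k f = cong (f 0 +_) (trans (cong (λ l → ∑ l f) (sym (map-upTo suc k))) (∑-map suc (upTo k) f))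

  ∑-allFin-≡ : ∀ {n} (i : Fin n) → ∑ (allFin n) (λ j → 𝟙 (i Fin.≟ j)) ≡ 1
  ∑-allFin-≡ {suc n} i = trans (cong (λ l → 𝟙 (i Fin.≟ zero) + ∑ l (λ j → 𝟙 (i Fin.≟ j))) (sym (map-tabulate id suc)))
    (trans (cong (𝟙 (i Fin.≟ zero) +_) (∑-map suc (allFin n) (λ j → 𝟙 (i Fin.≟ j)))) (go i))
    where
    go : ∀ i → 𝟙 (i Fin.≟ zero) + ∑ (allFin n) (λ j → 𝟙 (i Fin.≟ suc j)) ≡ 1
    go zero    = cong suc (∑-0 (allFin n) λ _ → refl)
    go (suc i) = trans (∑-cong (allFin n) λ j → 𝟙-⇔ (suc i Fin.≟ suc j) (i Fin.≟ j) Fin.suc-injective (cong suc)) (∑-allFin-≡ i)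

  -- The series of R ^ (- (σ + 1)) with R = r + 1 sums to 1/r. In the induction, the tail multiplied
  -- by R satisfies the same hypothesis.
  geometric-∑ : ∀ r k (a : ℕ → ℕ) T → (∀ σ → a σ * suc r ^ suc σ ≤ T) → r * ∑ (upTo k) a ≤ T
  geometric-∑ r zero    a T le rewrite *-zeroʳ r = z≤n
  geometric-∑ r (suc k) a T le = *-cancelˡ-≤ R (begin
    R * (r * ∑ (upTo (suc k)) a)          ≡⟨ cong (λ x → R * (r * x)) (∑-upTo-suc k a) ⟩
    R * (r * (a 0 + S))                   ≡⟨ Rr[x+y]≡rxR+rRy R r (a 0) S ⟩
    r * (a 0 * R) + r * (R * S)           ≤⟨ +-mono-≤ (*-monoʳ-≤ r (subst (λ x → a 0 * x ≤ T) (*-identityʳ R) (le 0))) tail ⟩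
    r * T + T                             ≡⟨ +-comm (r * T) T ⟩
    R * T                                 ∎)
    where
    open ≤-Reasoning
    R = suc r
    S = ∑ (upTo k) (a ∘ suc)
    tail : r * (R * S) ≤ T
    tail = subst (λ x → r * x ≤ T) (∑-*ˡ (upTo k) R (a ∘ suc)) (geometric-∑ r k (λ σ → R * a (suc σ)) T λ σ →
      subst (_≤ T) (sym (xy∙z≈y∙xz R (a (suc σ)) (R ^ suc σ))) (le (suc σ)))

  -- The sample space of `iid` without its weights.
  tuples : ∀ m → List A → List (Vec A m)
  tuples zero    xs = [ [] ]
  tuples (suc m) xs = cartesianProductWith _∷_ xs (tuples m xs)

  ∏ : ∀ {m} → (A → ℕ) → Vec A m → ℕ
  ∏ g []       = 1
  ∏ g (x ∷ xs) = g x * ∏ g xs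

  ∏-mono : ∀ {m} {f g : A → ℕ} → (∀ x → f x ≤ g x) → (xs : Vec A m) → ∏ f xs ≤ ∏ g xs
  ∏-mono f≤g []       = ≤-refl
  ∏-mono f≤g (x ∷ xs) = *-mono-≤ (f≤g x) (∏-mono f≤g xs)

  ∏-* : ∀ {m} (f g : A → ℕ) (xs : Vec A m) → ∏ f xs * ∏ g xs ≡ ∏ (λ x → f x * g x) xs
  ∏-* f g []       = refl
  ∏-* f g (x ∷ xs) = trans ([m*n]*[o*p]≡[m*o]*[n*p] (f x) (∏ f xs) (g x) (∏ g xs)) (cong (f x * g x *_) (∏-* f g xs))

  ∏-≥1 : ∀ {m} (g : A → ℕ) (xs : Vec A m) → (∀ k → 1 ≤ g (lookup xs k)) → 1 ≤ ∏ g xs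
  ∏-≥1 g []       1≤g = ≤-refl
  ∏-≥1 g (x ∷ xs) 1≤g = *-mono-≤ (1≤g zero) (∏-≥1 g xs (1≤g ∘ suc))

  ∏-≡0 : ∀ {m} (g : A → ℕ) (xs : Vec A m) k → g (lookup xs k) ≡ 0 → ∏ g xs ≡ 0
  ∏-≡0 g (x ∷ xs) zero    eq rewrite eq = refl
  ∏-≡0 g (x ∷ xs) (suc k) eq rewrite ∏-≡0 g xs k eq = *-zeroʳ (g x)

  -- Independence in counting form: the expectation of a product over the coordinates factorises.
  ∑-tuples : ∀ m (xs : List A) g → ∑ (tuples m xs) (∏ g) ≡ ∑ xs g ^ m
  ∑-tuples zero    xs g = refl
  ∑-tuples (suc m) xs g = begin
    ∑ (tuples (suc m) xs) (∏ g)                          ≡⟨ ∑-cartesianProductWith _∷_ xs (tuples m xs) (∏ g) ⟩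
    ∑ xs (λ x → ∑ (tuples m xs) (λ v → g x * ∏ g v))     ≡⟨ ∑-* xs (tuples m xs) g (∏ g) ⟨
    ∑ xs g * ∑ (tuples m xs) (∏ g)                       ≡⟨ cong (∑ xs g *_) (∑-tuples m xs g) ⟩
    ∑ xs g * ∑ xs g ^ m                                  ∎
    where open ≡-Reasoning

  ∏-1 : ∀ {m} (xs : Vec A m) → ∏ (λ _ → 1) xs ≡ 1
  ∏-1 []       = refl
  ∏-1 (x ∷ xs) = trans (+-identityʳ _) (∏-1 xs)

  length-tuples : ∀ m (xs : List A) → length (tuples m xs) ≡ length xs ^ m
  length-tuples m xs = begin
    length (tuples m xs)              ≡⟨ ∑-1 (tuples m xs) ⟨
    ∑ (tuples m xs) (λ _ → 1)         ≡⟨ ∑-cong (tuples m xs) ∏-1 ⟨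
    ∑ (tuples m xs) (∏ (λ _ → 1))     ≡⟨ ∑-tuples m xs (λ _ → 1) ⟩
    ∑ xs (λ _ → 1) ^ m                ≡⟨ cong (_^ m) (∑-1 xs) ⟩
    length xs ^ m                     ∎
    where open ≡-Reasoning

  ∈-subsets : ∀ {n} (p : Subset n) → p ∈ˡ subsets n
  ∈-subsets []                  = here refl
  ∈-subsets {suc n} (outside ∷ p) = ∈-++⁺ˡ (∈-map⁺ (outside ∷_) (∈-subsets p))
  ∈-subsets {suc n} (inside ∷ p)  = ∈-++⁺ʳ (map (outside ∷_) (subsets n)) (∈-map⁺ (inside ∷_) (∈-subsets p))

  -- Pascal's rule, by whether `W` contains the first element. The two conditions are multiplied as
  -- indicators because `∑-filter` produces that form.
  ∑-subsets-⊆ : ∀ {n} d (p : Subset n) → ∑ (subsets n) (λ W → 𝟙 (∣ W ∣ ℕ.≟ d) * 𝟙 (W ⊆? p)) ≡ ∣ p ∣ C d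
  ∑-subsets-⊆ zero    []      = refl
  ∑-subsets-⊆ (suc d) []      = sym (k>n⇒nCk≡0 {0} {suc d} (s≤s z≤n))
  ∑-subsets-⊆ {suc n} d (x ∷ p) = begin
    ∑ (map (outside ∷_) Ws ++ map (inside ∷_) Ws) (f d (x ∷ p))
      ≡⟨ ∑-++ (map (outside ∷_) Ws) _ (f d (x ∷ p)) ⟩
    ∑ (map (outside ∷_) Ws) (f d (x ∷ p)) + ∑ (map (inside ∷_) Ws) (f d (x ∷ p))
      ≡⟨ cong₂ _+_ (∑-map (outside ∷_) Ws _) (∑-map (inside ∷_) Ws _) ⟩
    ∑ Ws (λ W → f d (x ∷ p) (outside ∷ W)) + ∑ Ws (λ W → f d (x ∷ p) (inside ∷ W))
      ≡⟨ cong (_+ ∑ Ws (λ W → f d (x ∷ p) (inside ∷ W))) (trans (∑-cong Ws λ W → cong (𝟙 (∣ W ∣ ℕ.≟ d) *_) (𝟙-⇔ (outside ∷ W ⊆? x ∷ p) (W ⊆? p) drop-∷-⊆ out⊆)) (∑-subsets-⊆ d p)) ⟩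
    (∣ p ∣ C d) + ∑ Ws (λ W → f d (x ∷ p) (inside ∷ W))
      ≡⟨ insides x d ⟩
    ∣ x ∷ p ∣ C d ∎
    where
    open ≡-Reasoning
    Ws = subsets n
    f : ∀ {n} → ℕ → Subset n → Subset n → ℕ
    f d p W = 𝟙 (∣ W ∣ ℕ.≟ d) * 𝟙 (W ⊆? p)
    insides : ∀ x d → (∣ p ∣ C d) + ∑ Ws (λ W → f d (x ∷ p) (inside ∷ W)) ≡ ∣ x ∷ p ∣ C d
    insides outside d = trans (cong ((∣ p ∣ C d) +_) (∑-0 Ws λ W →
        trans (cong (𝟙 (suc ∣ W ∣ ℕ.≟ d) *_) (𝟙-false (inside ∷ W ⊆? outside ∷ p) λ W⊆p → zero∉ (W⊆p Vec.here))) (*-zeroʳ (𝟙 (suc ∣ W ∣ ℕ.≟ d)))))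
      (+-identityʳ _)
      where
      zero∉ : ¬ (zero ∈ outside ∷ p)
      zero∉ ()
    insides inside zero = cong suc (∑-0 Ws λ W → refl)
    insides inside (suc d) = begin
      (∣ p ∣ C suc d) + ∑ Ws (λ W → f (suc d) (inside ∷ p) (inside ∷ W))
        ≡⟨ cong ((∣ p ∣ C suc d) +_) (trans (∑-cong Ws λ W → cong₂ _*_
             (𝟙-⇔ (suc ∣ W ∣ ℕ.≟ suc d) (∣ W ∣ ℕ.≟ d) suc-injective (cong suc))
             (𝟙-⇔ (inside ∷ W ⊆? inside ∷ p) (W ⊆? p) drop-∷-⊆ in⊆in)) (∑-subsets-⊆ d p)) ⟩
      (∣ p ∣ C suc d) + (∣ p ∣ C d)     ≡⟨ +-comm (∣ p ∣ C suc d) _ ⟩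
      (∣ p ∣ C d) + (∣ p ∣ C suc d)     ≡⟨ nCk+nC[k+1]≡[n+1]C[k+1] ∣ p ∣ d ⟩
      suc ∣ p ∣ C suc d                 ∎

  ∑-subsetsOfSize-⊆ : ∀ {n} d (p : Subset n) → ∑ (subsetsOfSize n d) (λ W → 𝟙 (W ⊆? p)) ≡ ∣ p ∣ C d
  ∑-subsetsOfSize-⊆ {n} d p = trans (∑-filter (λ W → ∣ W ∣ ℕ.≟ d) (subsets n) (λ W → 𝟙 (W ⊆? p))) (∑-subsets-⊆ d p)

  length-subsetsOfSize : ∀ n d → length (subsetsOfSize n d) ≡ n C d
  length-subsetsOfSize n d = begin
    length L                        ≡⟨ ∑-1 L ⟨
    ∑ L (λ _ → 1)                   ≡⟨ ∑-cong L (λ W → 𝟙-true (W ⊆? ⊤) ⊆⊤) ⟨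
    ∑ L (λ W → 𝟙 (W ⊆? ⊤))          ≡⟨ ∑-subsetsOfSize-⊆ {n} d ⊤ ⟩
    ∣ ⊤ {n} ∣ C d                   ≡⟨ cong (_C d) (∣⊤∣≡n n) ⟩
    n C d                           ∎
    where
    open ≡-Reasoning
    L = subsetsOfSize n d

  length-tuples-subsets : ∀ n m d → length (tuples m (subsetsOfSize n d)) ≡ (n C d) ^ m
  length-tuples-subsets n m d = trans (length-tuples m (subsetsOfSize n d)) (cong (_^ m) (length-subsetsOfSize n d))

  ⊆∁⁅i⁆⇒i∉ : ∀ {n} (W : Subset n) {i} → W ⊆ ∁ ⁅ i ⁆ → i ∉ W
  ⊆∁⁅i⁆⇒i∉ W {i} W⊆ i∈W = x∈∁p⇒x∉p (W⊆ i∈W) (x∈⁅x⁆ i)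

  ∣∁⁅i⁆∣≡n : ∀ {n} (i : Fin (suc n)) → ∣ ∁ ⁅ i ⁆ ∣ ≡ n
  ∣∁⁅i⁆∣≡n {n} i = trans (∣∁p∣≡n∸∣p∣ ⁅ i ⁆) (cong (suc n ∸_) (∣⁅x⁆∣≡1 i))

  -- Isolated nodes and the second moment

  isolated⇒¬connected : ∀ {n m} (V : Vec (Subset (2 + n)) m) i → (∀ k → i ∉ lookup V k) → ¬ Connected (G V)
  isolated⇒¬connected {n} V i i∉V connected with other i
    where
    other : ∀ i → ∃[ j ] i ≢ j
    other zero    = suc zero , λ ()
    other (suc i) = zero , λ ()
  ... | j , i≢j with connected i j
  ... | ε                         = i≢j refl
  ... | (_ , k , i∈Vₖ , _) ◅ _ = i∉V k i∈Vₖ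

  #connected : (n m d : ℕ) → ℕ
  #connected n m d = ∑ (tuples m (subsetsOfSize n d)) (λ V → 𝟙 (connected? (adjacent? V)))

  -- There are 2 + n nodes, so that the d-sets avoiding none, one or two of them are counted without
  -- subtraction. `U` counts the tuples leaving a given node uncovered, `D` bounds those leaving two
  -- uncovered, and α/β is the expected number of uncovered nodes.
  module Isolated (n m d : ℕ) where

    private
      ν = 2 + n
      L = subsetsOfSize ν d
      T = tuples m L
      N = ν C d
      U = (suc n C d) ^ m
      β = N ^ m
      α = ν * U
      D = (n C d) ^ m
      connections = #connected ν m d

    -- Avoidance is phrased as inclusion in a complement so that `∑-subsetsOfSize-⊆` counts it.
    avoids : Fin ν → Subset ν → ℕ
    avoids i W = 𝟙 (W ⊆? ∁ ⁅ i ⁆)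

    isolated : Fin ν → Vec (Subset ν) m → ℕ
    isolated i = ∏ (avoids i)

    #isolated : Vec (Subset ν) m → ℕ
    #isolated V = ∑ (allFin ν) (λ i → isolated i V)

    connected⇒#isolated≡0 : ∀ V → Connected (G V) → #isolated V ≡ 0
    connected⇒#isolated≡0 V connected =
      ∑-0 (allFin ν) none
      where
      none : ∀ i → isolated i V ≡ 0
      none i with Fin.any? (λ k → i ∈? lookup V k)
      ... | yes (k , i∈) = ∏-≡0 (avoids i) V k (𝟙-false (lookup V k ⊆? ∁ ⁅ i ⁆) λ ⊆∁ → ⊆∁⁅i⁆⇒i∉ (lookup V k) ⊆∁ i∈)
      ... | no  ∄k       = contradiction connected (isolated⇒¬connected V i λ k i∈ → ∄k (k , i∈))

    ∑-const-allFin : ∀ c → ∑ (allFin ν) (λ _ → c) ≡ ν * c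
    ∑-const-allFin c = trans (∑-const (allFin ν) c) (cong (_* c) (length-tabulate {n = ν} id))

    ∑-isolated : ∀ i → ∑ T (isolated i) ≡ U
    ∑-isolated i = trans (∑-tuples m L (avoids i))
      (cong (_^ m) (trans (∑-subsetsOfSize-⊆ d (∁ ⁅ i ⁆)) (cong (_C d) (∣∁⁅i⁆∣≡n i))))

    ∑-#isolated : ∑ T #isolated ≡ α
    ∑-#isolated = begin
      ∑ T #isolated                                ≡⟨ ∑-swap T (allFin ν) (λ V i → isolated i V) ⟩
      ∑ (allFin ν) (λ i → ∑ T (isolated i))        ≡⟨ ∑-cong (allFin ν) ∑-isolated ⟩
      ∑ (allFin ν) (λ _ → U)                       ≡⟨ ∑-const-allFin U ⟩
      α                                            ∎
      where open ≡-Reasoning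

    avoids-both : ∀ {i j} → i ≢ j → ∀ W → avoids i W * avoids j W ≤ 𝟙 (W ⊆? ∁ ⁅ i ⁆ - j)
    avoids-both {i} {j} i≢j W with W ⊆? ∁ ⁅ i ⁆ | W ⊆? ∁ ⁅ j ⁆
    ... | no _    | _       = z≤n
    ... | yes _   | no _    = z≤n
    ... | yes W⊆i | yes W⊆j = ≤-reflexive (sym (𝟙-true (W ⊆? ∁ ⁅ i ⁆ - j) λ {x} x∈W →
      x∈p∧x≢y⇒x∈p-y (W⊆i x∈W) λ { refl → ⊆∁⁅i⁆⇒i∉ W W⊆j x∈W }))

    ∣∁⁅i⁆-j∣≤n : ∀ {i j : Fin ν} → i ≢ j → ∣ ∁ ⁅ i ⁆ - j ∣ ≤ n
    ∣∁⁅i⁆-j∣≤n {i} {j} i≢j = s≤s⁻¹ (≤-trans (x∈p⇒∣p-x∣<∣p∣ (x∉p⇒x∈∁p (x≢y⇒x∉⁅y⁆ (i≢j ∘ sym)))) (≤-reflexive (∣∁⁅i⁆∣≡n i)))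

    -- On the diagonal an indicator equals its square; off it, at most n nodes remain available.
    -- Allowing `D` on the diagonal too makes the bound uniform, and `Chebyshev-cancel` tolerates
    -- the excess.
    ∑-isolated² : ∀ i j → ∑ T (λ V → isolated i V * isolated j V) ≤ 𝟙 (i Fin.≟ j) * U + D
    ∑-isolated² i j with i Fin.≟ j
    ... | yes refl = ≤-trans (∑-mono T (λ V → ≤-trans (≤-reflexive (∏-* (avoids i) (avoids i) V)) (∏-mono idem V)))
                      (≤-trans (≤-reflexive (trans (∑-isolated i) (sym (+-identityʳ U)))) (m≤m+n (U + 0) D))
      where
      idem : ∀ W → avoids i W * avoids i W ≤ avoids i W
      idem W with does (W ⊆? ∁ ⁅ i ⁆)
      ... | true  = ≤-refl
      ... | false = z≤n
    ... | no i≢j = begin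
      ∑ T (λ V → isolated i V * isolated j V)
        ≤⟨ ∑-mono T (λ V → ≤-trans (≤-reflexive (∏-* (avoids i) (avoids j) V)) (∏-mono (avoids-both i≢j) V)) ⟩
      ∑ T (∏ (λ W → 𝟙 (W ⊆? ∁ ⁅ i ⁆ - j)))                 ≡⟨ trans (∑-tuples m L _) (cong (_^ m) (∑-subsetsOfSize-⊆ d (∁ ⁅ i ⁆ - j))) ⟩
      (∣ ∁ ⁅ i ⁆ - j ∣ C d) ^ m                            ≤⟨ ^-monoˡ-≤ m (C-monoˡ-≤ d (∣∁⁅i⁆-j∣≤n i≢j)) ⟩
      D                                                    ∎
      where open ≤-Reasoning

    ∑-#isolated² : ∑ T (λ V → #isolated V * #isolated V) ≤ α + ν * (ν * D)
    ∑-#isolated² = begin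
      ∑ T (λ V → #isolated V * #isolated V)
        ≡⟨ ∑-cong T (λ V → ∑-* (allFin ν) (allFin ν) (λ i → isolated i V) (λ j → isolated j V)) ⟩
      ∑ T (λ V → ∑ (allFin ν) (λ i → ∑ (allFin ν) (λ j → isolated i V * isolated j V)))
        ≡⟨ trans (∑-swap T (allFin ν) _) (∑-cong (allFin ν) λ i → ∑-swap T (allFin ν) _) ⟩
      ∑ (allFin ν) (λ i → ∑ (allFin ν) (λ j → ∑ T (λ V → isolated i V * isolated j V)))
        ≤⟨ ∑-mono (allFin ν) (λ i → ∑-mono (allFin ν) (∑-isolated² i)) ⟩
      ∑ (allFin ν) (λ i → ∑ (allFin ν) (λ j → 𝟙 (i Fin.≟ j) * U + D))
        ≡⟨ ∑-cong (allFin ν) (λ i → trans (∑-+ (allFin ν) (λ j → 𝟙 (i Fin.≟ j) * U) (λ _ → D)) (cong₂ _+_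
             (trans (∑-*ʳ (allFin ν) U (λ j → 𝟙 (i Fin.≟ j))) (trans (cong (_* U) (∑-allFin-≡ i)) (*-identityˡ U))) (∑-const-allFin D))) ⟩
      ∑ (allFin ν) (λ i → U + ν * D)
        ≡⟨ ∑-const-allFin (U + ν * D) ⟩
      ν * (U + ν * D)
        ≡⟨ *-distribˡ-+ ν U (ν * D) ⟩
      α + ν * (ν * D) ∎
      where open ≤-Reasoning

    -- Chebyshev's inequality: sum (α - β X)² ≥ 0, where the square is α² if X = 0, over all tuples.
    second-moment : connections * α ≤ β * β
    second-moment = Chebyshev-cancel connections α β ν D U refl
      -- Negative correlation: log-concavity handles a single d-set, and independence raises it to
      -- the power m.
      (≤-trans (≤-reflexive (trans (*-comm β D) (sym (^-distribʳ-* m (n C d) N))))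
        (≤-trans (^-monoˡ-≤ m (C-log-concave n d)) (≤-reflexive (^-distribʳ-* m (suc n C d) (suc n C d)))))
      (begin
        connections * (α * α) + 2 * (α * β) * α
          ≡⟨ cong₂ _+_ (sym (∑-*ʳ T (α * α) _)) (trans (cong (2 * (α * β) *_) (sym ∑-#isolated)) (sym (∑-*ˡ T (2 * (α * β)) #isolated))) ⟩
        ∑ T (λ V → 𝟙 (connected? (adjacent? V)) * (α * α)) + ∑ T (λ V → 2 * (α * β) * #isolated V)
          ≡⟨ ∑-+ T _ _ ⟨
        ∑ T (λ V → 𝟙 (connected? (adjacent? V)) * (α * α) + 2 * (α * β) * #isolated V)
          ≤⟨ ∑-mono T (λ V → pointwise V (connected? (adjacent? V))) ⟩
        ∑ T (λ V → α * α + β * β * (#isolated V * #isolated V))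
          ≡⟨ trans (∑-+ T _ _) (cong₂ _+_ (trans (∑-const T (α * α)) (cong (_* (α * α)) (length-tuples-subsets ν m d))) (∑-*ˡ T (β * β) _)) ⟩
        β * (α * α) + β * β * ∑ T (λ V → #isolated V * #isolated V)
          ≤⟨ +-monoʳ-≤ _ (*-monoʳ-≤ (β * β) ∑-#isolated²) ⟩
        β * (α * α) + β * β * (α + ν * (ν * D)) ∎)
      where
      open ≤-Reasoning
      pointwise : ∀ V (c? : Dec (Connected (G V))) →
        𝟙 c? * (α * α) + 2 * (α * β) * #isolated V ≤ α * α + β * β * (#isolated V * #isolated V)
      pointwise V (no  _) = square-bound α β (#isolated V)
      pointwise V (yes c) = subst (λ x → 1 * (α * α) + 2 * (α * β) * x ≤ α * α + β * β * (x * x))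
        (sym (connected⇒#isolated≡0 V c)) (≤-reflexive (square-bound-at-0 α β))

  -- Disconnection, separating sets and the union bound

  Separates : ∀ {n m} → Vec (Subset n) m → Subset n → Set
  Separates V S = ∀ k → lookup V k ⊆ S ⊎ lookup V k ⊆ ∁ S

  -- Double negation commutes with finite conjunction. Hence reachability may be taken as decided
  -- for all pairs at once under a double negation, which disappears at the decidable inequality of
  -- `separation⇒1≤∑`.
  ¬¬-Fin-∀ : ∀ {n} {R : Fin n → Set} → (∀ i → ¬ ¬ R i) → ¬ ¬ (∀ i → R i)
  ¬¬-Fin-∀ {zero}  ¬¬R ¬∀ = ¬∀ λ ()
  ¬¬-Fin-∀ {suc n} ¬¬R ¬∀ = ¬¬R zero λ r₀ → ¬¬-Fin-∀ (¬¬R ∘ suc) λ r → ¬∀ (Fin.∀-cons r₀ r)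

  module Component {n m} (V : Vec (Subset n) m) (reach? : ∀ i j → Dec (Star (G V) i j)) where

    component : Fin n → Subset n
    component i = Vec.tabulate (λ x → does (reach? i x))

    ∈-component⁺ : ∀ {i x} → Star (G V) i x → x ∈ component i
    ∈-component⁺ {i} {x} p = lookup⇒[]= x (component i) (trans (lookup∘tabulate _ x) (dec-true (reach? i x) p))

    ∈-component⁻ : ∀ {i x} → x ∈ component i → Star (G V) i x
    ∈-component⁻ {i} {x} x∈ with reach? i x | trans (sym (lookup∘tabulate (λ x → does (reach? i x)) x)) ([]=⇒lookup x∈)
    ... | yes p | _ = p

    -- Each V_k is a clique: if one of its nodes is reachable from i, all of them are.
    component-separates : ∀ i → Separates V (component i)
    component-separates i k with lookup V k ⊆? component i
    ... | yes ⊆S = inj₁ ⊆S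
    ... | no  ⊈S = inj₂ λ {y} y∈W → x∉p⇒x∈∁p λ y∈S → ⊈S λ {z} z∈W → ∈-component⁺ (extend (∈-component⁻ y∈S) y∈W z∈W)
      where
      extend : ∀ {y z} → Star (G V) i y → y ∈ lookup V k → z ∈ lookup V k → Star (G V) i z
      extend {y} {z} p y∈W z∈W with y Fin.≟ z
      ... | yes refl = p
      ... | no  y≢z  = p ◅◅ ((y≢z , k , y∈W , z∈W) ◅ ε)

  ¬connected⇒Separates : ∀ {n m} (V : Vec (Subset n) m) → ¬ Connected (G V) →
    ¬ ¬ (∃[ S ] ∃[ i ] ∃[ j ] (i ∈ S × j ∈ ∁ S × Separates V S))
  ¬connected⇒Separates {n} V ¬connected ¬∃ =
    ¬¬-Fin-∀ (λ i → ¬¬-Fin-∀ (λ j → ¬¬-excluded-middle {A = Star (G V) i j})) λ reach? →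
    let open Component V reach?
        i , ¬reach = Fin.¬∀⟶∃¬ n (λ i → ∀ j → Star (G V) i j) (λ i → Fin.all? (reach? i)) ¬connected
        j , i↛j    = Fin.¬∀⟶∃¬ n (Star (G V) i) (reach? i) ¬reach
    in ¬∃ (component i , i , j , ∈-component⁺ ε , x∉p⇒x∈∁p (i↛j ∘ ∈-component⁻) , component-separates i)

  ∣p∣+∣∁p∣≡n : ∀ {n} (p : Subset n) → ∣ p ∣ + ∣ ∁ p ∣ ≡ n
  ∣p∣+∣∁p∣≡n p = trans (cong (∣ p ∣ +_) (∣∁p∣≡n∸∣p∣ p)) (m+[n∸m]≡n (∣p∣≤n p))

  x∈p⇒1≤∣p∣ : ∀ {n} {p : Subset n} {x} → x ∈ p → 1 ≤ ∣ p ∣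
  x∈p⇒1≤∣p∣ x∈p = ≤-trans (s≤s z≤n) (x∈p⇒∣p-x∣<∣p∣ x∈p)

  module Disconnected (n m d : ℕ) where

    private
      L = subsetsOfSize n d
      T = tuples m L
      connections = #connected n m d

    -- A sum of two indicators rather than the indicator of a disjunction: its total over all d-sets
    -- is a sum of two binomials at once, and only a lower bound by 1 is required of it.
    one-sided : Subset n → Subset n → ℕ
    one-sided S W = 𝟙 (W ⊆? S) + 𝟙 (W ⊆? ∁ S)

    -- The set size is σ + 1, which excludes the empty set. The leading indicator restricts to at
    -- most half of the nodes, so that σ can run over all of `upTo n`.
    #separations : ℕ → Vec (Subset n) m → ℕ
    #separations σ V = 𝟙 (suc σ + suc σ ≤? n) * ∑ (subsetsOfSize n (suc σ)) (λ S → ∏ (one-sided S) V)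

    count-separation : ∀ V S {i} → i ∈ S → ∣ S ∣ + ∣ S ∣ ≤ n → Separates V S → 1 ≤ ∑ (upTo n) (λ σ → #separations σ V)
    count-separation V S i∈S 2∣S∣≤n sep = count ∣ S ∣ refl (x∈p⇒1≤∣p∣ i∈S) 2∣S∣≤n
      where
      open ≤-Reasoning
      count : ∀ s → ∣ S ∣ ≡ s → 1 ≤ s → s + s ≤ n → 1 ≤ ∑ (upTo n) (λ σ → #separations σ V)
      count (suc σ) ∣S∣≡s _ 2s≤n = begin
        1                                        ≤⟨ ∏-≥1 (one-sided S) V factor≥1 ⟩
        ∏ (one-sided S) V                        ≤⟨ ∑-∈ (λ S → ∏ (one-sided S) V) (∈-filter⁺ (λ p → ∣ p ∣ ℕ.≟ suc σ) (∈-subsets S) ∣S∣≡s) ⟩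
        Σ′                                       ≡⟨ trans (cong (_* Σ′) (𝟙-true (suc σ + suc σ ≤? n) 2s≤n)) (*-identityˡ Σ′) ⟨
        #separations σ V                         ≤⟨ ∑-∈ (λ σ → #separations σ V) (∈-upTo⁺ (≤-trans (m≤m+n (suc σ) (suc σ)) 2s≤n)) ⟩
        ∑ (upTo n) (λ σ → #separations σ V)      ∎
        where
        Σ′ = ∑ (subsetsOfSize n (suc σ)) (λ S → ∏ (one-sided S) V)
        factor≥1 : ∀ k → 1 ≤ one-sided S (lookup V k)
        factor≥1 k with sep k
        ... | inj₁ ⊆S  = ≤-trans (≤-reflexive (sym (𝟙-true (lookup V k ⊆? S) ⊆S))) (m≤m+n _ _)
        ... | inj₂ ⊆∁S = ≤-trans (≤-reflexive (sym (𝟙-true (lookup V k ⊆? ∁ S) ⊆∁S))) (m≤n+m _ _)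

    separation⇒1≤∑ : ∀ V → ¬ Connected (G V) → 1 ≤ ∑ (upTo n) (λ σ → #separations σ V)
    -- An inequality of naturals is decidable, hence stable, so a doubly negated separating set
    -- suffices. Of the set and its complement, the smaller one is counted.
    separation⇒1≤∑ V ¬c = decidable-stable (1 ≤? _) λ ¬1≤ → ¬connected⇒Separates V ¬c λ
      (S , i , j , i∈S , j∈∁S , sep) → ¬1≤ (smaller-side S i∈S j∈∁S sep)
      where
      flip-side : ∀ S → Separates V S → Separates V (∁ S)
      flip-side S sep k with sep k
      ... | inj₁ ⊆S  = inj₂ λ x∈ → x∉p⇒x∈∁p (x∈p⇒x∉∁p (⊆S x∈))
      ... | inj₂ ⊆∁S = inj₁ ⊆∁S
      smaller-side : ∀ S {i j} → i ∈ S → j ∈ ∁ S → Separates V S → 1 ≤ ∑ (upTo n) (λ σ → #separations σ V)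
      smaller-side S i∈S j∈∁S sep with ≤-total ∣ S ∣ ∣ ∁ S ∣
      ... | inj₁ ≤ = count-separation V S i∈S (≤-trans (+-monoʳ-≤ ∣ S ∣ ≤) (≤-reflexive (∣p∣+∣∁p∣≡n S))) sep
      ... | inj₂ ≥ = count-separation V (∁ S) j∈∁S (≤-trans (+-monoˡ-≤ ∣ ∁ S ∣ ≥) (≤-reflexive (∣p∣+∣∁p∣≡n S))) (flip-side S sep)

    ∑-#separations : ∀ σ → let s = suc σ in
      ∑ T (#separations σ) ≤ 𝟙 (s + s ≤? n) * ((n C s) * ((s C d) + ((n ∸ s) C d)) ^ m)
    ∑-#separations σ = begin
      ∑ T (#separations σ)
        ≡⟨ ∑-*ˡ T (𝟙 (s + s ≤? n)) (λ V → ∑ Ss (λ S → ∏ (one-sided S) V)) ⟩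
      𝟙 (s + s ≤? n) * ∑ T (λ V → ∑ Ss (λ S → ∏ (one-sided S) V))
        ≡⟨ cong (𝟙 (s + s ≤? n) *_) (∑-swap T Ss (λ V S → ∏ (one-sided S) V)) ⟩
      𝟙 (s + s ≤? n) * ∑ Ss (λ S → ∑ T (∏ (one-sided S)))
        ≤⟨ *-monoʳ-≤ (𝟙 (s + s ≤? n)) (∑-mono-∈ Ss λ {S} S∈ →
             ≤-reflexive (∑-one-sided S (proj₂ (∈-filter⁻ (λ p → ∣ p ∣ ℕ.≟ s) {xs = subsets n} S∈)))) ⟩
      𝟙 (s + s ≤? n) * ∑ Ss (λ _ → ((s C d) + ((n ∸ s) C d)) ^ m)
        ≡⟨ cong (𝟙 (s + s ≤? n) *_) (trans (∑-const Ss _) (cong (_* ((s C d) + ((n ∸ s) C d)) ^ m) (length-subsetsOfSize n s))) ⟩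
      𝟙 (s + s ≤? n) * ((n C s) * ((s C d) + ((n ∸ s) C d)) ^ m) ∎
      where
      open ≤-Reasoning
      s = suc σ
      Ss = subsetsOfSize n s
      ∑-one-sided : ∀ S → ∣ S ∣ ≡ s → ∑ T (∏ (one-sided S)) ≡ ((s C d) + ((n ∸ s) C d)) ^ m
      ∑-one-sided S ∣S∣≡s = subst (λ s → ∑ T (∏ (one-sided S)) ≡ ((s C d) + ((n ∸ s) C d)) ^ m) ∣S∣≡s (trans (∑-tuples m L (one-sided S)) (cong (_^ m)
        (trans (∑-+ L (λ W → 𝟙 (W ⊆? S)) (λ W → 𝟙 (W ⊆? ∁ S)))
          (cong₂ _+_ (∑-subsetsOfSize-⊆ d S) (trans (∑-subsetsOfSize-⊆ d (∁ S)) (cong (_C d) (∣∁p∣≡n∸∣p∣ S)))))))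

    -- Disconnection has probability at most 1/r: the expected number of separating sets of size s
    -- is at most (r + 1) ^ (- s), and these bounds sum to at most 1/r. The form is additive to
    -- avoid truncated subtraction.
    union-bound : ∀ r → 2 ≤ d → d ≤ n → (4 * suc r) ^ 2 * n * (n ∸ d) ^ m ≤ n ^ m →
      r * (n C d) ^ m ≤ r * connections + (n C d) ^ m
    union-bound r 2≤d d≤n hyp = begin
      r * (n C d) ^ m
        ≡⟨ cong (r *_) (trans (sym (length-tuples-subsets n m d)) (sym (∑-1 T))) ⟩
      r * ∑ T (λ _ → 1)
        ≤⟨ *-monoʳ-≤ r (∑-mono T λ V → pointwise V (connected? (adjacent? V))) ⟩
      r * ∑ T (λ V → 𝟙 (connected? (adjacent? V)) + ∑ (upTo n) (λ σ → #separations σ V))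
        ≡⟨ cong (r *_) (trans (∑-+ T _ _) (cong (connections +_) (∑-swap T (upTo n) (λ V σ → #separations σ V)))) ⟩
      r * (connections + ∑ (upTo n) (λ σ → ∑ T (#separations σ)))
        ≡⟨ *-distribˡ-+ r connections _ ⟩
      r * connections + r * ∑ (upTo n) (λ σ → ∑ T (#separations σ))
        ≤⟨ +-monoʳ-≤ (r * connections) (geometric-∑ r n _ ((n C d) ^ m) λ σ →
             ≤-trans (*-monoˡ-≤ (suc r ^ suc σ) (∑-#separations σ)) (half-cut σ (suc σ + suc σ ≤? n))) ⟩
      r * connections + (n C d) ^ m ∎
      where
      open ≤-Reasoning
      pointwise : ∀ V (c? : Dec (Connected (G V))) → 1 ≤ 𝟙 c? + ∑ (upTo n) (λ σ → #separations σ V)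
      pointwise V (yes c) = s≤s z≤n
      pointwise V (no ¬c) = separation⇒1≤∑ V ¬c
      half-cut : ∀ σ (2s≤n? : Dec (suc σ + suc σ ≤ n)) →
        𝟙 2s≤n? * ((n C suc σ) * ((suc σ C d) + ((n ∸ suc σ) C d)) ^ m) * suc r ^ suc σ ≤ (n C d) ^ m
      half-cut σ (no _)     = z≤n
      half-cut σ (yes 2s≤n) = ≤-trans (≤-reflexive (cong (_* suc r ^ suc σ) (*-identityˡ ((n C suc σ) * ((suc σ C d) + ((n ∸ suc σ) C d)) ^ m))))
        (expected-uncut′ n m d (suc r) σ 2≤d d≤n 2s≤n hyp)

-- Rational bounds extracted from the cuts of the logarithm

module Exponential where

  import Algebra.Definitions.RawSemiring
  import Algebra.Properties.CommutativeSemiring.Exp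
  open import Algebra.Bundles using (CommutativeRing)
  open import Data.Integer using (+_; -[1+_])
  import Data.Integer as ℤ
  import Data.Integer.Properties as ℤ
  open import Data.Nat as ℕ using (ℕ; zero; suc; NonZero)
  import Data.Nat.Properties as ℕ
  open import Data.Product using (_×_; _,_; proj₁; proj₂; ∃-syntax)
  open import Data.Rational using (ℚ; 0ℚ; 1ℚ; _+_; _-_; _*_; -_; _/_; _≤_; _<_; +-*-rawSemiring; toℚᵘ; mkℚ; 1/_; NonNegative; nonNegative; Positive; positive; *<*)
  open import Data.Rational.Properties
  open import Data.Rational.Solver using (module +-*-Solver)
  open import Data.Rational.Unnormalised as ℚᵘ using (mkℚᵘ; *≡*; *≤*)
  import Data.Rational.Unnormalised.Properties as ℚᵘ
  open import Data.Sum using (inj₁; inj₂)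
  open import Relation.Binary.PropositionalEquality using (_≡_; refl; sym; trans; cong; cong₂; subst; subst₂; module ≡-Reasoning)
  open import Defs

  open Algebra.Definitions.RawSemiring +-*-rawSemiring using (_^_)
  open Algebra.Properties.CommutativeSemiring.Exp (CommutativeRing.commutativeSemiring +-*-commutativeRing) using (^-distrib-*)
  open +-*-Solver using (solve; _:=_; _:+_; _:*_; :-_; con)

  toℚᵘ-/ : ∀ i n .{{_ : NonZero n}} → toℚᵘ (i / n) ℚᵘ.≃ i ℚᵘ./ n
  toℚᵘ-/ i (suc n) = toℚᵘ-fromℚᵘ (mkℚᵘ i n)

  fromℕ-+ : ∀ a b → fromℕ (a ℕ.+ b) ≡ fromℕ a + fromℕ b
  fromℕ-+ a b = toℚᵘ-injective (begin
    toℚᵘ (fromℕ (a ℕ.+ b))                 ≈⟨ toℚᵘ-/ (+ (a ℕ.+ b)) 1 ⟩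
    mkℚᵘ (+ (a ℕ.+ b)) 0                   ≈⟨ *≡* (cong (ℤ._* + 1) (sym (cong₂ ℤ._+_ (ℤ.*-identityʳ (+ a)) (ℤ.*-identityʳ (+ b))))) ⟩
    mkℚᵘ (+ a) 0 ℚᵘ.+ mkℚᵘ (+ b) 0         ≈⟨ ℚᵘ.+-cong (toℚᵘ-/ (+ a) 1) (toℚᵘ-/ (+ b) 1) ⟨
    toℚᵘ (fromℕ a) ℚᵘ.+ toℚᵘ (fromℕ b)     ≈⟨ toℚᵘ-homo-+ (fromℕ a) (fromℕ b) ⟨
    toℚᵘ (fromℕ a + fromℕ b)               ∎)
    where open ℚᵘ.≃-Reasoning

  fromℕ-* : ∀ a b → fromℕ (a ℕ.* b) ≡ fromℕ a * fromℕ b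
  fromℕ-* a b = toℚᵘ-injective (begin
    toℚᵘ (fromℕ (a ℕ.* b))                 ≈⟨ toℚᵘ-/ (+ (a ℕ.* b)) 1 ⟩
    mkℚᵘ (+ (a ℕ.* b)) 0                   ≈⟨ *≡* (cong (ℤ._* + 1) (ℤ.pos-* a b)) ⟩
    mkℚᵘ (+ a) 0 ℚᵘ.* mkℚᵘ (+ b) 0         ≈⟨ ℚᵘ.*-cong (toℚᵘ-/ (+ a) 1) (toℚᵘ-/ (+ b) 1) ⟨
    toℚᵘ (fromℕ a) ℚᵘ.* toℚᵘ (fromℕ b)     ≈⟨ toℚᵘ-homo-* (fromℕ a) (fromℕ b) ⟨
    toℚᵘ (fromℕ a * fromℕ b)               ∎)
    where open ℚᵘ.≃-Reasoning

  fromℕ-^ : ∀ a k → fromℕ (a ℕ.^ k) ≡ fromℕ a ^ k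
  fromℕ-^ a zero    = refl
  fromℕ-^ a (suc k) = trans (fromℕ-* a (a ℕ.^ k)) (cong (fromℕ a *_) (fromℕ-^ a k))

  d/n*n≡d : ∀ d n .{{_ : NonZero n}} → (+ d / n) * fromℕ n ≡ fromℕ d
  d/n*n≡d d n@(suc k) = toℚᵘ-injective (begin
    toℚᵘ ((+ d / n) * fromℕ n)             ≈⟨ toℚᵘ-homo-* (+ d / n) (fromℕ n) ⟩
    toℚᵘ (+ d / n) ℚᵘ.* toℚᵘ (fromℕ n)     ≈⟨ ℚᵘ.*-cong (toℚᵘ-/ (+ d) n) (toℚᵘ-/ (+ n) 1) ⟩
    mkℚᵘ (+ d) k ℚᵘ.* mkℚᵘ (+ n) 0         ≈⟨ *≡* (trans (ℤ.*-identityʳ _) (cong (λ x → + d ℤ.* + suc x) (sym (ℕ.*-identityʳ k)))) ⟩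
    mkℚᵘ (+ d) 0                           ≈⟨ toℚᵘ-/ (+ d) 1 ⟨
    toℚᵘ (fromℕ d)                         ∎)
    where open ℚᵘ.≃-Reasoning

  complement : ∀ {y a b} → b ℕ.≤ a → y * fromℕ a ≡ fromℕ b → (1ℚ - y) * fromℕ a ≡ fromℕ (a ℕ.∸ b)
  complement {y} {a} {b} b≤a y*a≡b = begin
    (1ℚ - y) * fromℕ a                      ≡⟨ distribute y (fromℕ a) ⟩
    fromℕ a - y * fromℕ a                   ≡⟨ cong₂ _-_ (cong fromℕ (sym (ℕ.m∸n+n≡m b≤a))) y*a≡b ⟩
    fromℕ (a ℕ.∸ b ℕ.+ b) - fromℕ b         ≡⟨ cong (_- fromℕ b) (fromℕ-+ (a ℕ.∸ b) b) ⟩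
    fromℕ (a ℕ.∸ b) + fromℕ b - fromℕ b     ≡⟨ cancel (fromℕ (a ℕ.∸ b)) (fromℕ b) ⟩
    fromℕ (a ℕ.∸ b)                         ∎
    where
    open ≡-Reasoning
    distribute : ∀ y z → (1ℚ - y) * z ≡ z - y * z
    distribute = solve 2 (λ y z → (con 1ℚ :+ (:- y)) :* z := z :+ (:- (y :* z))) refl
    cancel : ∀ y z → y + z - z ≡ y
    cancel = solve 2 (λ y z → y :+ z :+ (:- z) := y) refl

  fromℕ-mono-≤ : ∀ {a b} → a ℕ.≤ b → fromℕ a ≤ fromℕ b
  fromℕ-mono-≤ {a} {b} a≤b = toℚᵘ-cancel-≤ (ℚᵘ.≤-respˡ-≃ (ℚᵘ.≃-sym (toℚᵘ-/ (+ a) 1)) (ℚᵘ.≤-respʳ-≃ (ℚᵘ.≃-sym (toℚᵘ-/ (+ b) 1))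
    (*≤* (ℤ.*-monoʳ-≤-nonNeg (+ 1) (ℤ.+≤+ a≤b)))))

  fromℕ-cancel-≤ : ∀ {a b} → fromℕ a ≤ fromℕ b → a ℕ.≤ b
  fromℕ-cancel-≤ {a} {b} le with *≤* le′ ← ℚᵘ.≤-respˡ-≃ (toℚᵘ-/ (+ a) 1) (ℚᵘ.≤-respʳ-≃ (toℚᵘ-/ (+ b) 1) (toℚᵘ-mono-≤ le)) =
    ℤ.drop‿+≤+ (ℤ.*-cancelʳ-≤-pos (+ a) (+ b) (+ 1) le′)

  0≤fromℕ : ∀ a → 0ℚ ≤ fromℕ a
  0≤fromℕ a = fromℕ-mono-≤ {0} {a} ℕ.z≤n

  1≤fromℕ : ∀ a .{{_ : NonZero a}} → 1ℚ ≤ fromℕ a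
  1≤fromℕ a = fromℕ-mono-≤ {1} {a} (ℕ.>-nonZero⁻¹ a)

  0<1 : 0ℚ < 1ℚ
  0<1 = *<* (ℤ.+<+ (ℕ.s≤s ℕ.z≤n))

  fromℕ-pos : ∀ a .{{_ : NonZero a}} → Positive (fromℕ a)
  fromℕ-pos a = positive (<-≤-trans 0<1 (1≤fromℕ a))

  *-mono-≤-nonNeg : ∀ {a b c d} → 0ℚ ≤ a → 0ℚ ≤ c → a ≤ b → c ≤ d → a * c ≤ b * d
  *-mono-≤-nonNeg {a} {b} {c} {d} 0≤a 0≤c a≤b c≤d =
    ≤-trans (*-monoʳ-≤-nonNeg c {{nonNegative 0≤c}} a≤b) (*-monoˡ-≤-nonNeg b {{nonNegative (≤-trans 0≤a a≤b)}} c≤d)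

  0≤* : ∀ {a b} → 0ℚ ≤ a → 0ℚ ≤ b → 0ℚ ≤ a * b
  0≤* {a} {b} 0≤a 0≤b = subst (_≤ a * b) (*-zeroˡ b) (*-monoʳ-≤-nonNeg b {{nonNegative 0≤b}} 0≤a)

  0≤^ : ∀ {a} k → 0ℚ ≤ a → 0ℚ ≤ a ^ k
  0≤^ zero    0≤a = <⇒≤ 0<1
  0≤^ (suc k) 0≤a = 0≤* 0≤a (0≤^ k 0≤a)

  ^-mono-≤-nonNeg : ∀ k {a b} → 0ℚ ≤ a → a ≤ b → a ^ k ≤ b ^ k
  ^-mono-≤-nonNeg zero    0≤a a≤b = ≤-refl
  ^-mono-≤-nonNeg (suc k) 0≤a a≤b = *-mono-≤-nonNeg 0≤a (0≤^ k 0≤a) a≤b (^-mono-≤-nonNeg k 0≤a a≤b)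

  1^k≡1 : ∀ k → 1ℚ ^ k ≡ 1ℚ
  1^k≡1 zero    = refl
  1^k≡1 (suc k) = trans (*-identityˡ _) (1^k≡1 k)

  0≤p² : ∀ p → 0ℚ ≤ p * p
  0≤p² p with ≤-total 0ℚ p
  ... | inj₁ 0≤p = 0≤* 0≤p 0≤p

  ... | inj₂ p≤0 = subst (0ℚ ≤_) (solve 1 (λ p → (:- p) :* (:- p) := p :* p) refl p) (0≤* 0≤-p 0≤-p)
    where
    0≤-p : 0ℚ ≤ - p
    0≤-p = neg-antimono-≤ p≤0

  p≤fromℕ : ∀ p → ∃[ k ] p ≤ fromℕ k
  p≤fromℕ p@(mkℚ i d-1 _) = ℤ.∣ i ∣ , toℚᵘ-cancel-≤ (ℚᵘ.≤-respʳ-≃ (ℚᵘ.≃-sym (toℚᵘ-/ (+ ℤ.∣ i ∣) 1)) (*≤* (begin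
    i ℤ.* + 1             ≡⟨ ℤ.*-identityʳ i ⟩
    i                     ≤⟨ i≤∣i∣ i ⟩
    + ℤ.∣ i ∣             ≤⟨ ℤ.+≤+ (ℕ.m≤m*n ℤ.∣ i ∣ (suc d-1)) ⟩
    + (ℤ.∣ i ∣ ℕ.* suc d-1) ≡⟨ ℤ.pos-* ℤ.∣ i ∣ (suc d-1) ⟩
    + ℤ.∣ i ∣ ℤ.* + suc d-1 ∎)))
    where
    open ℤ.≤-Reasoning
    i≤∣i∣ : ∀ i → i ℤ.≤ + ℤ.∣ i ∣
    i≤∣i∣ (+ n)    = ℤ.≤-refl
    i≤∣i∣ -[1+ n ] = ℤ.-≤+

  -- The Archimedean property; taking one more than a bound for 1/ε makes it strict.
  1<fromℕ*ε : ∀ ε → 0ℚ < ε → ∃[ k ] 1ℚ < fromℕ k * ε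
  1<fromℕ*ε ε 0<ε = suc (proj₁ bound) , (begin-strict
    1ℚ                              ≡⟨ *-inverseˡ ε {{ε≢0}} ⟨
    (1/ ε) {{ε≢0}} * ε              ≤⟨ *-monoʳ-≤-nonNeg ε {{nonNegative (<⇒≤ 0<ε)}} (proj₂ bound) ⟩
    fromℕ k * ε                     ≡⟨ +-identityˡ (fromℕ k * ε) ⟨
    0ℚ + fromℕ k * ε                <⟨ +-monoˡ-< (fromℕ k * ε) 0<ε ⟩
    ε + fromℕ k * ε                 ≡⟨ cong (_+ fromℕ k * ε) (*-identityˡ ε) ⟨
    1ℚ * ε + fromℕ k * ε            ≡⟨ *-distribʳ-+ ε 1ℚ (fromℕ k) ⟨
    (1ℚ + fromℕ k) * ε              ≡⟨ cong (_* ε) (fromℕ-+ 1 k) ⟨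
    fromℕ (suc k) * ε               ∎)
    where
    open ≤-Reasoning
    ε≢0 = pos⇒nonZero ε {{positive 0<ε}}
    bound = p≤fromℕ ((1/ ε) {{ε≢0}})
    k = proj₁ bound

  -- The mesh of `expSeq`: `expSeq q k` is `(1ℚ + q * h k) ^ suc k`.
  h : ℕ → ℚ
  h k = + 1 / suc k

  h*[1+k]≡1 : ∀ k → h k * fromℕ (suc k) ≡ 1ℚ
  h*[1+k]≡1 k = d/n*n≡d 1 (suc k)

  0≤h : ∀ k → 0ℚ ≤ h k
  0≤h k = nonNegative⁻¹ (h k) {{normalize-nonNeg 1 (suc k)}}

  x*h≤ε : ∀ x ε → 0ℚ < ε → ∃[ N ] (∀ k → N ℕ.≤ k → x * h k ≤ ε)
  x*h≤ε x ε 0<ε = a ℕ.* b , λ k ab≤k → begin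
    x * h k                          ≤⟨ *-monoʳ-≤-nonNeg (h k) {{nonNegative (0≤h k)}} (proj₂ bound) ⟩
    fromℕ a * h k                    ≡⟨ cong (_* h k) (*-identityʳ (fromℕ a)) ⟨
    fromℕ a * 1ℚ * h k
      ≤⟨ *-monoʳ-≤-nonNeg (h k) {{nonNegative (0≤h k)}} (*-monoˡ-≤-nonNeg (fromℕ a) {{nonNegative (0≤fromℕ a)}} (<⇒≤ (proj₂ scale))) ⟩
    fromℕ a * (fromℕ b * ε) * h k    ≡⟨ solve 4 (λ a b ε h → a :* (b :* ε) :* h := ε :* (h :* (a :* b))) refl (fromℕ a) (fromℕ b) ε (h k) ⟩
    ε * (h k * (fromℕ a * fromℕ b))  ≡⟨ cong (λ x → ε * (h k * x)) (fromℕ-* a b) ⟨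
    ε * (h k * fromℕ (a ℕ.* b))
      ≤⟨ *-monoˡ-≤-nonNeg ε {{nonNegative (<⇒≤ 0<ε)}} (*-monoˡ-≤-nonNeg (h k) {{nonNegative (0≤h k)}} (fromℕ-mono-≤ {a ℕ.* b} {suc k} (ℕ.m≤n⇒m≤1+n ab≤k))) ⟩
    ε * (h k * fromℕ (suc k))        ≡⟨ cong (ε *_) (h*[1+k]≡1 k) ⟩
    ε * 1ℚ                           ≡⟨ *-identityʳ ε ⟩
    ε                                ∎
    where
    open ≤-Reasoning
    bound = p≤fromℕ x
    a = proj₁ bound
    scale = 1<fromℕ*ε ε 0<ε
    b = proj₁ scale

  p≤q⇒0≤q-p : ∀ {p q} → p ≤ q → 0ℚ ≤ q - p
  p≤q⇒0≤q-p {p} {q} p≤q = subst (_≤ q - p) (+-inverseʳ p) (+-monoˡ-≤ (- p) p≤q)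

  0≤q-p⇒p≤q : ∀ {p q} → 0ℚ ≤ q - p → p ≤ q
  0≤q-p⇒p≤q {p} {q} le = subst₂ _≤_ (+-identityˡ p) (solve 2 (λ p q → q :+ (:- p) :+ p := q) refl p q) (+-monoˡ-≤ p le)

  p<q⇒0<q-p : ∀ {p q} → p < q → 0ℚ < q - p
  p<q⇒0<q-p {p} {q} p<q = subst (_< q - p) (+-inverseʳ p) (+-monoˡ-< (- p) p<q)

  0≤1+p*h : ∀ p → ∃[ N ] (∀ k → N ℕ.≤ k → 0ℚ ≤ 1ℚ + p * h k)
  0≤1+p*h p = proj₁ small , λ k N≤k → subst (0ℚ ≤_) (negate p (h k)) (p≤q⇒0≤q-p {(- p) * h k} {1ℚ} (proj₂ small k N≤k))
    where
    small = x*h≤ε (- p) 1ℚ 0<1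
    negate : ∀ p x → 1ℚ - (- p * x) ≡ 1ℚ + p * x
    negate = solve 2 (λ p h → con 1ℚ :+ (:- ((:- p) :* h)) := con 1ℚ :+ p :* h) refl

  bernoulli : ∀ k x → 0ℚ ≤ 1ℚ + x → 1ℚ + fromℕ k * x ≤ (1ℚ + x) ^ k
  bernoulli zero    x 0≤1+x = ≤-reflexive (trans (cong (λ y → 1ℚ + y) (*-zeroˡ x)) (+-identityʳ 1ℚ))
  bernoulli (suc k) x 0≤1+x = begin
    1ℚ + fromℕ (suc k) * x                            ≡⟨ +-identityʳ _ ⟨
    1ℚ + fromℕ (suc k) * x + 0ℚ                       ≤⟨ +-monoʳ-≤ (1ℚ + fromℕ (suc k) * x) (0≤* (0≤fromℕ k) (0≤p² x)) ⟩
    1ℚ + fromℕ (suc k) * x + fromℕ k * (x * x)        ≡⟨ cong (λ c → 1ℚ + c * x + fromℕ k * (x * x)) (fromℕ-+ 1 k) ⟩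
    1ℚ + (1ℚ + fromℕ k) * x + fromℕ k * (x * x)
      ≡⟨ solve 2 (λ c x → con 1ℚ :+ (con 1ℚ :+ c) :* x :+ c :* (x :* x) := (con 1ℚ :+ x) :* (con 1ℚ :+ c :* x)) refl (fromℕ k) x ⟩
    (1ℚ + x) * (1ℚ + fromℕ k * x)                     ≤⟨ *-monoˡ-≤-nonNeg (1ℚ + x) {{nonNegative 0≤1+x}} (bernoulli k x 0≤1+x) ⟩
    (1ℚ + x) * (1ℚ + x) ^ k                           ∎
    where open ≤-Reasoning

  -- exp q * α ≤ β, for the limit exp q of expSeq q.
  ExpBound : ℚ → ℚ → ℚ → Set
  ExpBound q α β = ∀ p → p < q → ∃[ N ] (∀ k → N ℕ.≤ k → 0ℚ ≤ 1ℚ + p * h k × expSeq p k * α ≤ β)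

  -- exp q ≥ 1 + (q - 1).
  ExpBound⇒≤ : ∀ {q α β} → 0ℚ ≤ α → ExpBound q α β → q * α ≤ β
  ExpBound⇒≤ {q} {α} {β} 0≤α bound = begin
    q * α                                            ≡⟨ cong (_* α) (solve 1 (λ q → q := con 1ℚ :+ (q :+ (:- con 1ℚ)) :* con 1ℚ) refl q) ⟩
    (1ℚ + p * 1ℚ) * α                                ≡⟨ cong (λ x → (1ℚ + p * x) * α) (h*[1+k]≡1 N) ⟨
    (1ℚ + p * (h N * fromℕ (suc N))) * α
      ≡⟨ cong (λ x → (1ℚ + x) * α) (solve 3 (λ p h c → p :* (h :* c) := c :* (p :* h)) refl p (h N) (fromℕ (suc N))) ⟩
    (1ℚ + fromℕ (suc N) * (p * h N)) * α
      ≤⟨ *-monoʳ-≤-nonNeg α {{nonNegative 0≤α}} (bernoulli (suc N) (p * h N) (proj₁ bounded)) ⟩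
    expSeq p N * α                                   ≤⟨ proj₂ bounded ⟩
    β                                                ∎
    where
    open ≤-Reasoning
    p = q - 1ℚ
    p<q : p < q
    p<q = subst (p <_) (+-identityʳ q) (+-monoʳ-< q (neg-antimono-< 0<1))
    N = proj₁ (bound p p<q)
    bounded = proj₂ (bound p p<q) N ℕ.≤-refl

  1+ph-* : ∀ a b p k → - (a * b) * h k ≤ a + b - p → 1ℚ + p * h k ≤ (1ℚ + a * h k) * (1ℚ + b * h k)
  1+ph-* a b p k le = 0≤q-p⇒p≤q (subst (0ℚ ≤_)
    (solve 4 (λ a b p h → h :* ((a :+ b :+ (:- p)) :+ (:- ((:- (a :* b)) :* h))) :=
       ((con 1ℚ :+ a :* h) :* (con 1ℚ :+ b :* h)) :+ (:- (con 1ℚ :+ p :* h))) refl a b p (h k))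
    (0≤* (0≤h k) (p≤q⇒0≤q-p le)))

  -- The addition law of exp. At a finite k, (1 + ah)(1 + bh) differs from 1 + (a + b)h by abh².
  -- That error is absorbed by the gap between p and a + b once k is large, which is why `ExpBound`
  -- speaks of all p strictly below q.
  ExpBound-+ : ∀ {a b α α′ β β′} → 0ℚ ≤ α → 0ℚ ≤ α′ → ExpBound a α β → ExpBound b α′ β′ → ExpBound (a + b) (α * α′) (β * β′)
  ExpBound-+ {a} {b} {α} {α′} {β} {β′} 0≤α 0≤α′ A B p p<a+b = N , λ k N≤k → bound k
      (proj₂ N₀ k (ℕ.m+n≤o⇒m≤o _ N≤k))
      (proj₂ N₁ k (ℕ.m+n≤o⇒m≤o _ (ℕ.m+n≤o⇒n≤o (proj₁ N₀) N≤k)))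
      (proj₂ N₂ k (ℕ.m+n≤o⇒m≤o _ (ℕ.m+n≤o⇒n≤o (proj₁ N₁) (ℕ.m+n≤o⇒n≤o (proj₁ N₀) N≤k))))
      (proj₂ N₃ k (ℕ.m+n≤o⇒n≤o (proj₁ N₂) (ℕ.m+n≤o⇒n≤o (proj₁ N₁) (ℕ.m+n≤o⇒n≤o (proj₁ N₀) N≤k))))
    where
    open ≤-Reasoning
    shift : ∀ {x y z} → x < y + z → x - z < y
    shift {x} {y} {z} lt = subst (x - z <_) (solve 2 (λ y z → y :+ z :+ (:- z) := y) refl y z) (+-monoˡ-< (- z) lt)
    -- First a′ is chosen between p - b and a, then b′ between p - a′ and b; so p < a′ + b′ with
    -- room left below both a and b.
    below-a = <-dense (shift {p} {a} {b} p<a+b)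
    a′ = proj₁ below-a
    p<b+a′ : p < b + a′
    p<b+a′ = subst₂ _<_ (solve 2 (λ p b → p :+ (:- b) :+ b := p) refl p b) (+-comm a′ b) (+-monoˡ-< b (proj₁ (proj₂ below-a)))
    below-b = <-dense (shift {p} {b} {a′} p<b+a′)
    b′ = proj₁ below-b
    p<a′+b′ : p < a′ + b′
    p<a′+b′ = subst₂ _<_ (solve 2 (λ p b → p :+ (:- b) :+ b := p) refl p a′) (+-comm b′ a′) (+-monoˡ-< a′ (proj₁ (proj₂ below-b)))
    N₀ = 0≤1+p*h p
    N₁ = x*h≤ε (- (a′ * b′)) (a′ + b′ - p) (p<q⇒0<q-p p<a′+b′)
    N₂ = A a′ (proj₂ (proj₂ below-a))
    N₃ = B b′ (proj₂ (proj₂ below-b))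
    N = proj₁ N₀ ℕ.+ (proj₁ N₁ ℕ.+ (proj₁ N₂ ℕ.+ proj₁ N₃))
    bound : ∀ k → 0ℚ ≤ 1ℚ + p * h k → - (a′ * b′) * h k ≤ a′ + b′ - p →
      0ℚ ≤ 1ℚ + a′ * h k × expSeq a′ k * α ≤ β → 0ℚ ≤ 1ℚ + b′ * h k × expSeq b′ k * α′ ≤ β′ →
      0ℚ ≤ 1ℚ + p * h k × expSeq p k * (α * α′) ≤ β * β′
    bound k 0≤p small (0≤a , ≤β) (0≤b , ≤β′) = 0≤p , (begin
      expSeq p k * (α * α′)
        ≤⟨ *-monoʳ-≤-nonNeg (α * α′) {{nonNegative (0≤* 0≤α 0≤α′)}} (^-mono-≤-nonNeg (suc k) 0≤p (1+ph-* a′ b′ p k small)) ⟩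
      ((1ℚ + a′ * h k) * (1ℚ + b′ * h k)) ^ suc k * (α * α′)
        ≡⟨ cong (_* (α * α′)) (^-distrib-* (1ℚ + a′ * h k) (1ℚ + b′ * h k) (suc k)) ⟩
      expSeq a′ k * expSeq b′ k * (α * α′)
        ≡⟨ solve 4 (λ x y z w → x :* y :* (z :* w) := x :* z :* (y :* w)) refl (expSeq a′ k) (expSeq b′ k) α α′ ⟩
      expSeq a′ k * α * (expSeq b′ k * α′)
        ≤⟨ *-mono-≤-nonNeg (0≤* (0≤^ (suc k) 0≤a) 0≤α) (0≤* (0≤^ (suc k) 0≤b) 0≤α′) ≤β ≤β′ ⟩
      β * β′ ∎)

  log-below : ∀ {x q} → q <ʳ log x → ExpBound q 1ℚ x
  log-below {x} {q} (δ , 0<δ , N , bounded) p p<q = proj₁ nonNeg ℕ.+ N , λ k M≤k →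
    let 0≤1+ph = proj₂ nonNeg k (ℕ.m+n≤o⇒m≤o _ M≤k) in
    0≤1+ph , (begin
      expSeq p k * 1ℚ    ≡⟨ *-identityʳ (expSeq p k) ⟩
      expSeq p k         ≤⟨ ^-mono-≤-nonNeg (suc k) 0≤1+ph (+-monoʳ-≤ 1ℚ (*-monoʳ-≤-nonNeg (h k) {{nonNegative (0≤h k)}} (<⇒≤ p<q))) ⟩
      expSeq q k         ≡⟨ +-identityʳ (expSeq q k) ⟨
      expSeq q k + 0ℚ    ≤⟨ +-monoʳ-≤ (expSeq q k) (<⇒≤ 0<δ) ⟩
      expSeq q k + δ     ≤⟨ bounded k (ℕ.m+n≤o⇒n≤o (proj₁ nonNeg) M≤k) ⟩
      x                  ∎)
    where
    open ≤-Reasoning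
    nonNeg = 0≤1+p*h p

  -- The cut gives x ≤ exp q. It is multiplied by exp (- q) without division: for p < - q, (1 +
  -- ph)(1 + qh) ≤ 1 - (qh)² ≤ 1.
  log-above : ∀ {x q} → log x ʳ< q → ExpBound (- q) x 1ℚ
  log-above {x} {q} (δ , 0<δ , N , bounded) p p<-q = proj₁ nonNeg ℕ.+ (proj₁ nonNeg′ ℕ.+ N) , λ k M≤k →
    let 0≤1+ph = proj₂ nonNeg k (ℕ.m+n≤o⇒m≤o _ M≤k)
        0≤1+qh = proj₂ nonNeg′ k (ℕ.m+n≤o⇒m≤o _ (ℕ.m+n≤o⇒n≤o (proj₁ nonNeg) M≤k)) in
    0≤1+ph , (begin
      expSeq p k * x                  ≡⟨ cong (expSeq p k *_) (+-identityʳ x) ⟨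
      expSeq p k * (x + 0ℚ)           ≤⟨ *-monoˡ-≤-nonNeg (expSeq p k) {{nonNegative (0≤^ (suc k) 0≤1+ph)}} (≤-trans (+-monoʳ-≤ x (<⇒≤ 0<δ))
                                           (bounded k (ℕ.m+n≤o⇒n≤o (proj₁ nonNeg′) (ℕ.m+n≤o⇒n≤o (proj₁ nonNeg) M≤k)))) ⟩
      expSeq p k * expSeq q k         ≡⟨ ^-distrib-* (1ℚ + p * h k) (1ℚ + q * h k) (suc k) ⟨
      ((1ℚ + p * h k) * (1ℚ + q * h k)) ^ suc k
                                      ≤⟨ ^-mono-≤-nonNeg (suc k) (0≤* 0≤1+ph 0≤1+qh) (product≤1 k 0≤1+qh) ⟩
      1ℚ ^ suc k                      ≡⟨ 1^k≡1 (suc k) ⟩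
      1ℚ                              ∎)
    where
    open ≤-Reasoning
    nonNeg  = 0≤1+p*h p
    nonNeg′ = 0≤1+p*h q
    difference-of-squares : ∀ x → 1ℚ - (1ℚ + (- x)) * (1ℚ + x) ≡ x * x
    difference-of-squares = solve 1 (λ x → con 1ℚ :+ (:- ((con 1ℚ :+ (:- x)) :* (con 1ℚ :+ x))) := x :* x) refl
    product≤1 : ∀ k → 0ℚ ≤ 1ℚ + q * h k → (1ℚ + p * h k) * (1ℚ + q * h k) ≤ 1ℚ
    product≤1 k 0≤1+qh = ≤-trans
      (*-monoʳ-≤-nonNeg (1ℚ + q * h k) {{nonNegative 0≤1+qh}} (+-monoʳ-≤ 1ℚ
        (≤-trans (*-monoʳ-≤-nonNeg (h k) {{nonNegative (0≤h k)}} (<⇒≤ p<-q)) (≤-reflexive (sym (neg-distribˡ-* q (h k)))))))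
      (0≤q-p⇒p≤q (subst (0ℚ ≤_) (sym (difference-of-squares (q * h k))) (0≤p² (q * h k))))

  -- Covers the multiple with m = 0, where the cuts are those of `0ʳ` and the power is 1.
  ExpBound-neg : ∀ {q} → q < 0ℚ → ExpBound q 1ℚ 1ℚ
  ExpBound-neg {q} q<0 p p<q = proj₁ nonNeg , λ k N≤k →
    let 0≤1+ph = proj₂ nonNeg k N≤k in
    0≤1+ph , (begin
      expSeq p k * 1ℚ    ≡⟨ *-identityʳ (expSeq p k) ⟩
      expSeq p k         ≤⟨ ^-mono-≤-nonNeg (suc k) 0≤1+ph (1+ph≤1 k) ⟩
      1ℚ ^ suc k         ≡⟨ 1^k≡1 (suc k) ⟩
      1ℚ                 ∎)
    where
    open ≤-Reasoning
    nonNeg = 0≤1+p*h p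
    1+ph≤1 : ∀ k → 1ℚ + p * h k ≤ 1ℚ
    1+ph≤1 k = ≤-trans (+-monoʳ-≤ 1ℚ (≤-trans (*-monoʳ-≤-nonNeg (h k) {{nonNegative (0≤h k)}} (<⇒≤ (<-trans p<q q<0)))
      (≤-reflexive (*-zeroˡ (h k))))) (≤-reflexive (+-identityʳ 1ℚ))

  ·log-below : ∀ m {x q} → q <ʳ m ·ʳ log x → ExpBound q 1ℚ (x ^ m)
  ·log-below zero    q<0 = ExpBound-neg q<0
  ·log-below (suc m) {x} (a , b , a< , b< , refl) = subst (λ α → ExpBound (a + b) α (x ^ suc m)) (*-identityˡ 1ℚ)
    (ExpBound-+ (<⇒≤ 0<1) (<⇒≤ 0<1) (log-below {x} {a} a<) (·log-below m {x} {b} b<))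

  ·log-above : ∀ m {x q} → 0ℚ ≤ x → m ·ʳ log x ʳ< q → ExpBound (- q) (x ^ m) 1ℚ
  ·log-above zero    _   0<q = ExpBound-neg (neg-antimono-< 0<q)
  ·log-above (suc m) {x} 0≤x (a , b , <a , <b , refl) = subst₂ (λ q β → ExpBound q (x ^ suc m) β)
    (sym (neg-distrib-+ a b)) (*-identityˡ 1ℚ) (ExpBound-+ 0≤x (0≤^ m 0≤x) (log-above {x} {a} <a) (·log-above m {x} {b} 0≤x <b))

  -- From q ≤ exp q ≤ y x^m; the addition law collects one factor for each summand.
  log-sum-below : ∀ {y x q} m → q <ʳ log y +ʳ m ·ʳ log x → q ≤ y * x ^ m
  log-sum-below {y} {x} {q} m (a , b , a< , b< , refl) = subst (_≤ y * x ^ m) (*-identityʳ (a + b))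
    (ExpBound⇒≤ (<⇒≤ 0<1) (subst (λ α → ExpBound (a + b) α (y * x ^ m)) (*-identityˡ 1ℚ)
      (ExpBound-+ (<⇒≤ 0<1) (<⇒≤ 0<1) (log-below {y} {a} a<) (·log-below m {x} {b} b<))))

  -- From - q ≤ exp (- q) and exp (- q) y x^m ≤ 1. It is applied with q = - K for large K.
  log-sum-above : ∀ {y x q} m → 0ℚ ≤ y → 0ℚ ≤ x → log y +ʳ m ·ʳ log x ʳ< q → - q * (y * x ^ m) ≤ 1ℚ
  log-sum-above {y} {x} {q} m 0≤y 0≤x (a , b , <a , <b , refl) = ExpBound⇒≤ (0≤* 0≤y (0≤^ m 0≤x))
    (subst₂ (λ q β → ExpBound q (y * x ^ m) β) (sym (neg-distrib-+ a b)) (*-identityˡ 1ℚ)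
      (ExpBound-+ 0≤y (0≤^ m 0≤x) (log-above {y} {a} <a) (·log-above m {x} {b} 0≤x <b)))

  module Density (n d : ℕ) .{{_ : NonZero n}} (d≤n : d ℕ.≤ n) where

    x = 1ℚ - + d / n

    x*n≡n∸d : x * fromℕ n ≡ fromℕ (n ℕ.∸ d)
    x*n≡n∸d = complement {+ d / n} {n} {d} d≤n (d/n*n≡d d n)

    0≤x : 0ℚ ≤ x
    0≤x = *-cancelʳ-≤-pos (fromℕ n) {{fromℕ-pos n}} (begin
      0ℚ * fromℕ n      ≡⟨ *-zeroˡ (fromℕ n) ⟩
      0ℚ                ≤⟨ 0≤fromℕ (n ℕ.∸ d) ⟩
      fromℕ (n ℕ.∸ d)   ≡⟨ x*n≡n∸d ⟨
      x * fromℕ n       ∎)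
      where open ≤-Reasoning

    x^m*n^m : ∀ m → x ^ m * fromℕ (n ℕ.^ m) ≡ fromℕ ((n ℕ.∸ d) ℕ.^ m)
    x^m*n^m m = begin
      x ^ m * fromℕ (n ℕ.^ m)        ≡⟨ cong (x ^ m *_) (fromℕ-^ n m) ⟩
      x ^ m * fromℕ n ^ m            ≡⟨ ^-distrib-* x (fromℕ n) m ⟨
      (x * fromℕ n) ^ m              ≡⟨ cong (_^ m) x*n≡n∸d ⟩
      fromℕ (n ℕ.∸ d) ^ m            ≡⟨ fromℕ-^ (n ℕ.∸ d) m ⟨
      fromℕ ((n ℕ.∸ d) ℕ.^ m)        ∎
      where open ≡-Reasoning

    n^m-nonNeg : ∀ m → NonNegative (fromℕ (n ℕ.^ m))
    n^m-nonNeg m = nonNegative (0≤fromℕ (n ℕ.^ m))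

    -- This is K ≤ n x^m multiplied by n^m, the form used for counts; `above⇒≤` does the same for K
    -- n x^m ≤ 1.
    below⇒≤ : ∀ {K} m → fromℕ K <ʳ log[n]+m·log[1-d/n] n m d → K ℕ.* n ℕ.^ m ℕ.≤ n ℕ.* (n ℕ.∸ d) ℕ.^ m
    below⇒≤ {K} m K< = fromℕ-cancel-≤ {K ℕ.* n ℕ.^ m} {n ℕ.* (n ℕ.∸ d) ℕ.^ m} (begin
      fromℕ (K ℕ.* n ℕ.^ m)                     ≡⟨ fromℕ-* K (n ℕ.^ m) ⟩
      fromℕ K * fromℕ (n ℕ.^ m)                 ≤⟨ *-monoʳ-≤-nonNeg (fromℕ (n ℕ.^ m)) {{n^m-nonNeg m}} (log-sum-below {fromℕ n} {x} m K<) ⟩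
      fromℕ n * x ^ m * fromℕ (n ℕ.^ m)         ≡⟨ *-assoc (fromℕ n) (x ^ m) (fromℕ (n ℕ.^ m)) ⟩
      fromℕ n * (x ^ m * fromℕ (n ℕ.^ m))       ≡⟨ cong (fromℕ n *_) (x^m*n^m m) ⟩
      fromℕ n * fromℕ ((n ℕ.∸ d) ℕ.^ m)         ≡⟨ fromℕ-* n ((n ℕ.∸ d) ℕ.^ m) ⟨
      fromℕ (n ℕ.* (n ℕ.∸ d) ℕ.^ m)             ∎)
      where open ≤-Reasoning

    above⇒≤ : ∀ {K} m → log[n]+m·log[1-d/n] n m d ʳ< - fromℕ K → K ℕ.* n ℕ.* (n ℕ.∸ d) ℕ.^ m ℕ.≤ n ℕ.^ m
    above⇒≤ {K} m <-K = fromℕ-cancel-≤ {K ℕ.* n ℕ.* (n ℕ.∸ d) ℕ.^ m} {n ℕ.^ m} (begin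
      fromℕ (K ℕ.* n ℕ.* (n ℕ.∸ d) ℕ.^ m)
        ≡⟨ trans (fromℕ-* (K ℕ.* n) ((n ℕ.∸ d) ℕ.^ m)) (cong (_* fromℕ ((n ℕ.∸ d) ℕ.^ m)) (fromℕ-* K n)) ⟩
      fromℕ K * fromℕ n * fromℕ ((n ℕ.∸ d) ℕ.^ m)            ≡⟨ cong (fromℕ K * fromℕ n *_) (x^m*n^m m) ⟨
      fromℕ K * fromℕ n * (x ^ m * fromℕ (n ℕ.^ m))          ≡⟨ rearrange (fromℕ K) (fromℕ n) (x ^ m) (fromℕ (n ℕ.^ m)) ⟩
      - (- fromℕ K) * (fromℕ n * x ^ m) * fromℕ (n ℕ.^ m)
        ≤⟨ *-monoʳ-≤-nonNeg (fromℕ (n ℕ.^ m)) {{n^m-nonNeg m}} (log-sum-above {fromℕ n} {x} m (0≤fromℕ n) 0≤x <-K) ⟩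
      1ℚ * fromℕ (n ℕ.^ m)                                   ≡⟨ *-identityˡ _ ⟩
      fromℕ (n ℕ.^ m)                                        ∎)
      where
      open ≤-Reasoning
      rearrange : ∀ a b c d → a * b * (c * d) ≡ - (- a) * (b * c) * d
      rearrange = solve 4 (λ a b c d → a :* b :* (c :* d) := (:- (:- a)) :* (b :* c) :* d) refl

-- From counts to probabilities and limits

module Probability where

  import Algebra.Definitions.RawSemiring
  import Algebra.Properties.CommutativeSemiring.Exp
  open import Algebra.Bundles using (CommutativeRing)
  open import Data.Bool using (true; false)
  open import Data.Integer using (+_)
  open import Data.List using (List; []; _∷_; map; length; cartesianProductWith; _++_)
  open import Data.List.Properties using (map-++; map-∘)
  open import Data.Nat as ℕ using (ℕ; zero; suc; NonZero)
  open import Data.Nat.Combinatorics using (_C_)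
  import Data.Nat.Properties as ℕ
  open import Algebra.Properties.CommutativeSemigroup ℕ.*-commutativeSemigroup using (x∙yz≈y∙xz)
  open import Data.Product using (_×_; _,_; proj₁; proj₂)
  open import Data.Rational using (ℚ; 0ℚ; 1ℚ; _+_; _-_; _*_; -_; _/_; _≤_; _<_; +-*-rawSemiring; nonNegative; Positive) renaming (∣_∣ to abs)
  open import Data.Rational.Properties
  open import Data.Rational.Solver using (module +-*-Solver)
  open import Data.Vec using (Vec; _∷_)
  open import Function using (_∘_)
  open import Level using (0ℓ)
  open import Relation.Binary.PropositionalEquality using (_≡_; refl; sym; trans; cong; cong₂; subst; module ≡-Reasoning)
  open import Relation.Nullary using (does)
  open import Relation.Unary using (Pred; Decidable)
  open import Defs
  open Arithmetic
  open Counting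
  open Exponential

  open Algebra.Definitions.RawSemiring +-*-rawSemiring using (_^_)
  open Algebra.Properties.CommutativeSemiring.Exp (CommutativeRing.commutativeSemiring +-*-commutativeRing) using (^-distrib-*)
  open +-*-Solver using (solve; _:=_; _:+_; :-_; con)

  private
    variable
      A : Set

  Pr-constant : ∀ (xs : List A) w {P : Pred A 0ℓ} (P? : Decidable P) →
    Pr (map (λ x → x , w) xs) P? ≡ fromℕ (∑ xs (𝟙 ∘ P?)) * w
  Pr-constant []       w P? = sym (*-zeroˡ w)
  Pr-constant (x ∷ xs) w P? with does (P? x)
  ... | false = Pr-constant xs w P?
  ... | true  = begin
    w + Pr (map (λ x → x , w) xs) P?     ≡⟨ cong₂ _+_ (sym (*-identityˡ w)) (Pr-constant xs w P?) ⟩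
    1ℚ * w + fromℕ k * w                 ≡⟨ *-distribʳ-+ w 1ℚ (fromℕ k) ⟨
    (1ℚ + fromℕ k) * w                   ≡⟨ cong (_* w) (fromℕ-+ 1 k) ⟨
    fromℕ (suc k) * w                    ∎
    where
    open ≡-Reasoning
    k = ∑ xs (𝟙 ∘ P?)

  -- A product of equal weights is one constant weight, so the joint law is again uniform and
  -- probabilities reduce to counts.
  iid-constant : ∀ m w (xs : List A) → iid m (map (λ x → x , w) xs) ≡ map (λ v → v , w ^ m) (tuples m xs)
  iid-constant zero    w xs = refl
  iid-constant {A} (suc m) w xs rewrite iid-constant m w xs = go xs
    where
    ys = tuples m xs
    pair : A × ℚ → Vec A m × ℚ → Vec A (suc m) × ℚ
    pair (x , p) (xs , q) = x ∷ xs , p * q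
    go : ∀ xs → cartesianProductWith pair (map (λ x → x , w) xs) (map (λ v → v , w ^ m) ys) ≡
                map (λ v → v , w ^ suc m) (cartesianProductWith _∷_ xs ys)
    go []       = refl
    go (x ∷ xs) = trans (cong₂ _++_ (trans (sym (map-∘ ys)) (map-∘ ys)) (go xs)) (sym (map-++ _ (map (x ∷_) ys) _))

  Pr-uniform : ∀ m (xs : List A) .{{_ : NonZero (length xs)}} {P : Pred (Vec A m) 0ℓ} (P? : Decidable P) →
    Pr (iid m (uniform xs)) P? * fromℕ (length xs ℕ.^ m) ≡ fromℕ (∑ (tuples m xs) (𝟙 ∘ P?))
  Pr-uniform m xs@(_ ∷ _) P? = begin
    Pr (iid m (map (λ x → x , w) xs)) P? * fromℕ (ℓ ℕ.^ m)
      ≡⟨ cong₂ (λ μ y → Pr μ P? * y) (iid-constant m w xs) (fromℕ-^ ℓ m) ⟩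
    Pr (map (λ v → v , w ^ m) (tuples m xs)) P? * fromℕ ℓ ^ m
      ≡⟨ cong (_* fromℕ ℓ ^ m) (Pr-constant (tuples m xs) (w ^ m) P?) ⟩
    fromℕ c * w ^ m * fromℕ ℓ ^ m
      ≡⟨ *-assoc (fromℕ c) (w ^ m) (fromℕ ℓ ^ m) ⟩
    fromℕ c * (w ^ m * fromℕ ℓ ^ m)
      ≡⟨ cong (fromℕ c *_) (^-distrib-* w (fromℕ ℓ) m) ⟨
    fromℕ c * (w * fromℕ ℓ) ^ m
      ≡⟨ cong (λ y → fromℕ c * y ^ m) (d/n*n≡d 1 ℓ) ⟩
    fromℕ c * 1ℚ ^ m
      ≡⟨ cong (fromℕ c *_) (1^k≡1 m) ⟩
    fromℕ c * 1ℚ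
      ≡⟨ *-identityʳ (fromℕ c) ⟩
    fromℕ c ∎
    where
    open ≡-Reasoning
    ℓ = length xs
    w = + 1 / ℓ
    c = ∑ (tuples m xs) (𝟙 ∘ P?)

  ℙ-count : ∀ n m d → d ℕ.≤ n → ℙ[G-connected] n m d * fromℕ ((n C d) ℕ.^ m) ≡ fromℕ (#connected n m d)
  ℙ-count n m d d≤n = subst (λ ℓ → ℙ[G-connected] n m d * fromℕ (ℓ ℕ.^ m) ≡ fromℕ (#connected n m d)) (length-subsetsOfSize n d)
    (Pr-uniform m (subsetsOfSize n d) {{subst NonZero (sym (length-subsetsOfSize n d)) (nCk≢0 d≤n)}} (λ V → connected? (adjacent? V)))

  #connected≤ : ∀ n m d → #connected n m d ℕ.≤ (n C d) ℕ.^ m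
  #connected≤ n m d = ℕ.≤-trans (∑-mono T λ V → 𝟙≤1 (connected? (adjacent? V)))
    (ℕ.≤-reflexive (trans (∑-1 T) (length-tuples-subsets n m d)))
    where T = tuples m (subsetsOfSize n d)

  -- Since C(n-1, d)/C(n, d) = (n - d)/n, the expected number of uncovered nodes is n (1 - d/n)^m ≥
  -- K, and the second moment bounds the probability of connectedness by its reciprocal.
  subcritical : ∀ K n m d → 2 ℕ.≤ n → d ℕ.≤ n → K ℕ.* n ℕ.^ m ℕ.≤ n ℕ.* (n ℕ.∸ d) ℕ.^ m →
    K ℕ.* #connected n m d ℕ.≤ (n C d) ℕ.^ m
  subcritical K n@(suc (suc n-2)) m d (ℕ.s≤s (ℕ.s≤s _)) d≤n hyp =
    ℕ.*-cancelʳ-≤ _ _ (B ℕ.* n ℕ.^ m) {{ℕ.m*n≢0 B (n ℕ.^ m) {{B≢0}} {{ℕ.m^n≢0 n m}}}} (begin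
      K ℕ.* c ℕ.* (B ℕ.* n ℕ.^ m)                   ≡⟨ rearrange₁ K c B (n ℕ.^ m) ⟩
      c ℕ.* B ℕ.* (K ℕ.* n ℕ.^ m)                   ≤⟨ ℕ.*-monoʳ-≤ (c ℕ.* B) hyp ⟩
      c ℕ.* B ℕ.* (n ℕ.* (n ℕ.∸ d) ℕ.^ m)           ≡⟨ rearrange₂ c B n ((n ℕ.∸ d) ℕ.^ m) ⟩
      c ℕ.* (n ℕ.* ((n ℕ.∸ d) ℕ.^ m ℕ.* B))         ≡⟨ cong (λ x → c ℕ.* (n ℕ.* x)) powers ⟩
      c ℕ.* (n ℕ.* (n ℕ.^ m ℕ.* u ℕ.^ m))           ≡⟨ rearrange₃ c n (n ℕ.^ m) (u ℕ.^ m) ⟩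
      c ℕ.* (n ℕ.* u ℕ.^ m) ℕ.* n ℕ.^ m             ≤⟨ ℕ.*-monoˡ-≤ (n ℕ.^ m) (Isolated.second-moment n-2 m d) ⟩
      B ℕ.* B ℕ.* n ℕ.^ m                           ≡⟨ ℕ.*-assoc B B (n ℕ.^ m) ⟩
      B ℕ.* (B ℕ.* n ℕ.^ m)                         ∎)
    where
    open ℕ.≤-Reasoning
    c = #connected n m d
    B = (n C d) ℕ.^ m
    u = suc n-2 C d
    B≢0 : NonZero B
    B≢0 = ℕ.m^n≢0 (n C d) m {{nCk≢0 d≤n}}
    powers : (n ℕ.∸ d) ℕ.^ m ℕ.* B ≡ n ℕ.^ m ℕ.* u ℕ.^ m
    powers = trans (sym (^-distribʳ-* m (n ℕ.∸ d) (n C d)))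
      (trans (cong (ℕ._^ m) (sym ([1+n]*nCk≡[1+n∸k]*[1+n]Ck (suc n-2) d≤n))) (^-distribʳ-* m n u))
    rearrange₁ : ∀ K c B x → K ℕ.* c ℕ.* (B ℕ.* x) ≡ c ℕ.* B ℕ.* (K ℕ.* x)
    rearrange₁ K c B x = trans (cong (ℕ._* (B ℕ.* x)) (ℕ.*-comm K c)) (ℕ.[m*n]*[o*p]≡[m*o]*[n*p] c K B x)
    rearrange₂ : ∀ c B n x → c ℕ.* B ℕ.* (n ℕ.* x) ≡ c ℕ.* (n ℕ.* (x ℕ.* B))
    rearrange₂ c B n x = trans (ℕ.*-assoc c B (n ℕ.* x)) (cong (c ℕ.*_) (trans (x∙yz≈y∙xz B n x) (cong (n ℕ.*_) (ℕ.*-comm B x))))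
    rearrange₃ : ∀ c n x y → c ℕ.* (n ℕ.* (x ℕ.* y)) ≡ c ℕ.* (n ℕ.* y) ℕ.* x
    rearrange₃ c n x y = trans (cong (c ℕ.*_) (trans (cong (n ℕ.*_) (ℕ.*-comm x y)) (sym (ℕ.*-assoc n y x)))) (sym (ℕ.*-assoc c (n ℕ.* y) x))

  small-if-scaled : ∀ {y δ} K → fromℕ K * y ≤ 1ℚ → 1ℚ < fromℕ K * δ → y < δ
  small-if-scaled K Ky≤1 1<Kδ = *-cancelˡ-<-nonNeg (fromℕ K) {{nonNegative (0≤fromℕ K)}} (≤-<-trans Ky≤1 1<Kδ)

  module Ratio {x : ℚ} {B c : ℕ} (B≢0 : NonZero B) (x*B≡c : x * fromℕ B ≡ fromℕ c) where

    private instance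
      _ = B≢0
      B-pos : Positive (fromℕ B)
      B-pos = fromℕ-pos B

    open ≤-Reasoning

    0≤x : 0ℚ ≤ x
    0≤x = *-cancelʳ-≤-pos (fromℕ B) (begin
      0ℚ * fromℕ B  ≡⟨ *-zeroˡ (fromℕ B) ⟩
      0ℚ            ≤⟨ 0≤fromℕ c ⟩
      fromℕ c       ≡⟨ x*B≡c ⟨
      x * fromℕ B   ∎)

    Kx≤1 : ∀ K → K ℕ.* c ℕ.≤ B → fromℕ K * x ≤ 1ℚ
    Kx≤1 K Kc≤B = *-cancelʳ-≤-pos (fromℕ B) (begin
      fromℕ K * x * fromℕ B     ≡⟨ *-assoc (fromℕ K) x (fromℕ B) ⟩
      fromℕ K * (x * fromℕ B)   ≡⟨ cong (fromℕ K *_) x*B≡c ⟩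
      fromℕ K * fromℕ c         ≡⟨ fromℕ-* K c ⟨
      fromℕ (K ℕ.* c)           ≤⟨ fromℕ-mono-≤ {K ℕ.* c} {B} Kc≤B ⟩
      fromℕ B                   ≡⟨ *-identityˡ (fromℕ B) ⟨
      1ℚ * fromℕ B              ∎)

  ℙ-near-0 : ∀ {δ} K n m d → d ℕ.≤ n → K ℕ.* #connected n m d ℕ.≤ (n C d) ℕ.^ m → 1ℚ < fromℕ K * δ →
    abs (ℙ[G-connected] n m d - 0ℚ) < δ
  ℙ-near-0 {δ} K n m d d≤n Kc≤B 1<Kδ = subst (_< δ) (sym (trans (cong abs (+-identityʳ p)) (0≤p⇒∣p∣≡p 0≤x)))
    (small-if-scaled K (Kx≤1 K Kc≤B) 1<Kδ)
    where
    p = ℙ[G-connected] n m d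
    open Ratio {p} {(n C d) ℕ.^ m} {#connected n m d} (ℕ.m^n≢0 (n C d) m {{nCk≢0 d≤n}}) (ℙ-count n m d d≤n)

  ℙ-near-1 : ∀ {δ} K n m d → d ℕ.≤ n → K ℕ.* (n C d) ℕ.^ m ℕ.≤ K ℕ.* #connected n m d ℕ.+ (n C d) ℕ.^ m → 1ℚ < fromℕ K * δ →
    abs (ℙ[G-connected] n m d - 1ℚ) < δ
  ℙ-near-1 {δ} K n m d d≤n KB≤Kc+B 1<Kδ = subst (_< δ)
    (sym (trans (sym (∣-p∣≡∣p∣ (p - 1ℚ))) (trans (cong abs (negate p)) (0≤p⇒∣p∣≡p 0≤x))))
    (small-if-scaled K (Kx≤1 K (subst (ℕ._≤ B) (sym (ℕ.*-distribˡ-∸ K B c)) (ℕ.m≤n+o⇒m∸n≤o (K ℕ.* B) (K ℕ.* c) KB≤Kc+B))) 1<Kδ)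
    where
    p = ℙ[G-connected] n m d
    B = (n C d) ℕ.^ m
    c = #connected n m d
    B≢0 : NonZero B
    B≢0 = ℕ.m^n≢0 (n C d) m {{nCk≢0 d≤n}}
    -- The ratio considered is the probability of disconnection, (B - c)/B.
    open Ratio {1ℚ - p} {B} {B ℕ.∸ c} B≢0 (complement {p} {B} {c} (#connected≤ n m d) (ℙ-count n m d d≤n))
    negate : ∀ p → - (p - 1ℚ) ≡ 1ℚ - p
    negate = solve 1 (λ p → :- (p :+ (:- con 1ℚ)) := con 1ℚ :+ (:- p)) refl

  module Threshold (m d : ℕ → ℕ) (hyp : ∀ n → 2 ℕ.≤ n → 1 ℕ.≤ m n × 2 ℕ.≤ d n × d n ℕ.≤ n) where

    to-0 : (λ n → log[n]+m·log[1-d/n] n (m n) (d n)) ⟶+∞ → (λ n → ℙ[G-connected] n (m n) (d n)) ⟶ 0ℚ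
    to-0 diverges δ 0<δ = N ℕ.+ 2 , bound
      where
      K = proj₁ (1<fromℕ*ε δ 0<δ)
      N = proj₁ (diverges (fromℕ K))
      bound : ∀ n → N ℕ.+ 2 ℕ.≤ n → abs (ℙ[G-connected] n (m n) (d n) - 0ℚ) < δ
      bound n N+2≤n = ℙ-near-0 K n (m n) (d n) d≤n
        (subcritical K n (m n) (d n) 2≤n d≤n (Density.below⇒≤ n (d n) d≤n {K} (m n) (proj₂ (diverges (fromℕ K)) n (ℕ.m+n≤o⇒m≤o N N+2≤n))))
        (proj₂ (1<fromℕ*ε δ 0<δ))
        where
        2≤n = ℕ.m+n≤o⇒n≤o N N+2≤n
        d≤n = proj₂ (proj₂ (hyp n 2≤n))
        instance
          n≢0 : NonZero n
          n≢0 = ℕ.>-nonZero (ℕ.≤-trans (ℕ.s≤s ℕ.z≤n) 2≤n)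

    to-1 : (λ n → log[n]+m·log[1-d/n] n (m n) (d n)) ⟶-∞ → (λ n → ℙ[G-connected] n (m n) (d n)) ⟶ 1ℚ
    to-1 diverges δ 0<δ = N ℕ.+ 2 , bound
      where
      K = proj₁ (1<fromℕ*ε δ 0<δ)
      -- The constant in the hypothesis of `union-bound` for r = K, whose conclusion 1/K is below δ.
      R = (4 ℕ.* suc K) ℕ.^ 2
      N = proj₁ (diverges (- fromℕ R))
      bound : ∀ n → N ℕ.+ 2 ℕ.≤ n → abs (ℙ[G-connected] n (m n) (d n) - 1ℚ) < δ
      bound n N+2≤n = ℙ-near-1 K n (m n) (d n) d≤n
        (Disconnected.union-bound n (m n) (d n) K 2≤d d≤n (Density.above⇒≤ n (d n) d≤n {R} (m n) (proj₂ (diverges (- fromℕ R)) n (ℕ.m+n≤o⇒m≤o N N+2≤n))))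
        (proj₂ (1<fromℕ*ε δ 0<δ))
        where
        2≤n = ℕ.m+n≤o⇒n≤o N N+2≤n
        2≤d = proj₁ (proj₂ (hyp n 2≤n))
        d≤n = proj₂ (proj₂ (hyp n 2≤n))
        instance
          n≢0 : NonZero n
          n≢0 = ℕ.>-nonZero (ℕ.≤-trans (ℕ.s≤s ℕ.z≤n) 2≤n)

open import Defs
open import Data.Nat using (ℕ; _≤_; NonZero)
open import Data.Product using (_×_; _,_)
open import Data.Rational using (0ℚ; 1ℚ)

mainTheorem4 : (m d : ℕ → ℕ) →
    (∀ n → 2 ≤ n → 1 ≤ m n × 2 ≤ d n × d n ≤ n) →
    ((λ n → log[n]+m·log[1-d/n] n (m n) (d n)) ⟶+∞ →
    (λ n → ℙ[G-connected] n (m n) (d n)) ⟶ 0ℚ)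
    ×
    ((λ n → log[n]+m·log[1-d/n] n (m n) (d n)) ⟶-∞ →
    (λ n → ℙ[G-connected] n (m n) (d n)) ⟶ 1ℚ)
mainTheorem4 m d hyp = to-0 , to-1
  where open Probability.Threshold m d hyp
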